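{- Let $\Gamma,\Delta$ be multi-sorted constraint languages over finite collections of finite sets $\mathcal D=\{D_t:t\in T\}$ and $\mathcal E=\{E_s:s\in S\}$, respectively, and suppose $\Gamma$ pp-interprets $\Delta$. Then $\textsc{IMP}_d(\Delta)$ is polynomial time reducible to $\textsc{IMP}_{O(d)}(\Gamma)$.
   Context: Multi-sorted relations, multi-sorted constraint languages, $\textsc{MCSP}$ instances, their ideals and $\textsc{IMP}_d$: a multi-sorted relation over $\mathcal D$ of signature $(t_1,\dots,t_m)$ is a subset of $D_{t_1}\times\dots\times D_{t_m}$; an instance $(X,\mathcal D,\delta,\mathcal C)$ assigns each variable $x$ a sort $\delta(x)$ and imposes constraints $\langle(x_1,\dots,x_m),R\rangle$ with $R$ of signature $(\delta(x_1),\dots,\delta(x_m))$; all domains lie in a field $\mathbb F$; the ideal of an instance is the ideal of $\mathbb F[X]$ of polynomials vanishing on the solution set (generated by domain polynomials $\prod_{a\in D_{\delta(x)}}(x-a)$ and interpolating polynomials of the constraints); $\textsc{IMP}_d$ asks, given an instance and a polynomial of degree at most $d$, whether the polynomial lies in that ideal. pp-definability: $\Gamma$ pp-defines a relation if it is expressible as $\exists x_1\dots x_m\,L$ with $L$ a conjunction of atoms from $\Gamma$ and equalities, sort-consistent. pp-interpretation: $\Delta$ is finite, and for every $s\in S$ there are $i_{s,1},\dots,i_{s,\ell_s}\in T$, a set $F_s\subseteq D_{i_{s,1}}\times\dots\times D_{i_{s,\ell_s}}$ and an onto map $\pi_s:F_s\to E_s$ such that $\Gamma$ pp-defines (1) each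 $F_s$, (2) the $\pi_s$-preimage of the equality relation on $E_s$, and (3) for every $Q\in\Delta$, $Q\subseteq E_{s_1}\times\dots\times E_{s_k}$, the relation $\pi^{ -1}(Q)$ of arity $\sum_i\ell_{s_i}$ consisting of all $(x_{1,1},\dots,x_{1,\ell_{s_1}},\dots,x_{k,1},\dots,x_{k,\ell_{s_k}})$ with $(\pi_{s_1}(x_{1,1},\dots,x_{1,\ell_{s_1}}),\dots,\pi_{s_k}(x_{k,1},\dots,x_{k,\ell_{s_k}}))\in Q$. $\textsc{IMP}_{O(d)}(\Gamma)$ means $\textsc{IMP}_{cd}(\Gamma)$ for a constant $c$ depending only on $\Gamma,\Delta$. -}

module Defs where

open import Level using (Level; _⊔_; 0ℓ) renaming (suc to lsuc)
open import Algebra.Apartness.Bundles using (HeytingField)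
open import Data.Bool.Base using (Bool; true; false; T)
open import Data.Fin.Base using (Fin; toℕ)
open import Data.List.Base
  using (List; []; _∷_; _++_; foldr; length; concatMap; filterᵇ; allFin; cartesianProductWith)
open import Data.List.Membership.Propositional using (_∈_)
open import Data.List.Relation.Unary.All as All using (All; []; _∷_)
open import Data.List.Relation.Unary.All.Properties using () renaming (++⁺ to _++ᵗ_)
open import Data.List.Relation.Unary.Any using (index)
open import Data.Nat.Base using (ℕ; zero; suc; _≤_; _^_) renaming (_+_ to _+ℕ_; _*_ to _*ℕ_)
open import Data.Product.Base using (Σ; ∃; _×_; _,_; proj₁; proj₂)
open import Function.Base using (_∘_)
open import Function.Bundles using (_⇔_; _↔_)
open import Function.Definitions using (Injective; StrictlySurjective)
open import Relation.Binary.Definitions using (Decidable)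
open import Relation.Binary.PropositionalEquality.Core using (_≡_)
open import Relation.Nullary.Decidable.Core using (yes; no)
open import Relation.Unary using (Pred)

-- A family of majorants cofinal among the polynomials in n.
poly : ℕ → ℕ → ℕ
poly k n = k *ℕ suc n ^ k

-- A field in the classical sense: a Heyting field with decidable apartness.
record DiscreteField (c ℓ₁ ℓ₂ : Level) : Set (lsuc (c ⊔ ℓ₁ ⊔ ℓ₂)) where
  field
    heytingField : HeytingField c ℓ₁ ℓ₂
  open HeytingField heytingField public
  field
    _#?_ : Decidable _#_

  -- The library inverts differences of apart elements, here x - 0#.
  inv : Carrier → Carrier
  inv x with x #? 0#
  ... | yes x#0 = proj₁ (#⇒invertible x#0)
  ... | no  _   = 0#

-- ‖ x ‖ is the space charged for storing x.  Constant ‖_‖ gives the unit-cost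
-- (algebraic) model, available over every field; over ℚ the bit length gives
-- the logarithmic-cost model.
record SizedField (c ℓ₁ ℓ₂ : Level) : Set (lsuc (c ⊔ ℓ₁ ⊔ ℓ₂)) where
  field
    discreteField : DiscreteField c ℓ₁ ℓ₂
  open DiscreteField discreteField public
  field
    ‖_‖        : Carrier → ℕ
    growth     : ℕ
    +-growth   : ∀ x y → ‖ x + y ‖ ≤ poly growth (‖ x ‖ +ℕ ‖ y ‖)
    *-growth   : ∀ x y → ‖ x * y ‖ ≤ poly growth (‖ x ‖ +ℕ ‖ y ‖)
    neg-growth : ∀ x → ‖ - x ‖ ≤ poly growth ‖ x ‖
    inv-growth : ∀ x → ‖ inv x ‖ ≤ poly growth ‖ x ‖

-- WHILE programs on binary trees whose leaves are nil or field elements, as the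
-- model of computation.  Every step is charged the full size of the trees it
-- reads and writes, so no exponentially large tree can be built cheaply by
-- sharing.

module _ {c ℓ₁ ℓ₂} (𝔽 : SizedField c ℓ₁ ℓ₂) where
  open SizedField 𝔽 using (Carrier)

  data Tree : Set c where
    nil  : Tree
    atom : Carrier → Tree
    cons : Tree → Tree → Tree

  data Prim : Set c where
    const                    : Tree → Prim
    ident hd tl              : Prim
    add mul neg invert equal : Prim

  data Prog : Set c where
    prim          : Prim → Prog
    _⨾_           : Prog → Prog → Prog
    pair          : Prog → Prog → Prog
    if_then_else_ : Prog → Prog → Prog → Prog
    while_run_    : Prog → Prog → Prog

module _ {c ℓ₁ ℓ₂} {𝔽 : SizedField c ℓ₁ ℓ₂} where
  open SizedField 𝔽

  size : Tree 𝔽 → ℕ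
  size nil        = 1
  size (atom x)   = suc ‖ x ‖
  size (cons u v) = suc (size u +ℕ size v)

  -- Conses count as true.
  truth : Tree 𝔽 → Bool
  truth (cons _ _) = true
  truth _          = false

  -- On arguments of the wrong shape the result is nil.
  ⟦_⟧ : Prim 𝔽 → Tree 𝔽 → Tree 𝔽
  ⟦ const w ⟧ _                        = w
  ⟦ ident ⟧   v                        = v
  ⟦ hd ⟧      (cons u _)               = u
  ⟦ tl ⟧      (cons _ v)               = v
  ⟦ add ⟧     (cons (atom x) (atom y)) = atom (x + y)
  ⟦ mul ⟧     (cons (atom x) (atom y)) = atom (x * y)
  ⟦ neg ⟧     (atom x)                 = atom (- x)
  ⟦ invert ⟧  (atom x)                 = atom (inv x)
  ⟦ equal ⟧   (cons (atom x) (atom y)) with x #? y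
  ... | yes _ = nil
  ... | no  _ = cons nil nil
  ⟦ _ ⟧       _                        = nil

  infix 3 _⊢_⇓_[_]

  -- p ⊢ u ⇓ v [ t ]: started on u, p halts with result v after time t.
  data _⊢_⇓_[_] : Prog 𝔽 → Tree 𝔽 → Tree 𝔽 → ℕ → Set c where
    prim  : ∀ {o u} → prim o ⊢ u ⇓ ⟦ o ⟧ u [ size u +ℕ size (⟦ o ⟧ u) ]
    seq   : ∀ {p q u v w s t} →
            p ⊢ u ⇓ v [ s ] → q ⊢ v ⇓ w [ t ] →
            p ⨾ q ⊢ u ⇓ w [ s +ℕ t ]
    pair  : ∀ {p q u v w s t} →
            p ⊢ u ⇓ v [ s ] → q ⊢ u ⇓ w [ t ] →
            pair p q ⊢ u ⇓ cons v w [ size u +ℕ (s +ℕ t) ]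
    if-true     : ∀ {r p q u b v s t} →
                  r ⊢ u ⇓ b [ s ] → truth b ≡ true → p ⊢ u ⇓ v [ t ] →
                  if r then p else q ⊢ u ⇓ v [ size u +ℕ (s +ℕ t) ]
    if-false    : ∀ {r p q u b v s t} →
                  r ⊢ u ⇓ b [ s ] → truth b ≡ false → q ⊢ u ⇓ v [ t ] →
                  if r then p else q ⊢ u ⇓ v [ size u +ℕ (s +ℕ t) ]
    while-false : ∀ {r p u b s} →
                  r ⊢ u ⇓ b [ s ] → truth b ≡ false →
                  while r run p ⊢ u ⇓ u [ size u +ℕ s ]
    while-true  : ∀ {r p u b v w s t t′} →
                  r ⊢ u ⇓ b [ s ] → truth b ≡ true →
                  p ⊢ u ⇓ v [ t ] → while r run p ⊢ v ⇓ w [ t′ ] →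
                  while r run p ⊢ u ⇓ w [ size u +ℕ (s +ℕ (t +ℕ t′)) ]

-- A promise problem: inputs are the encodings of instances.
record Problem {c ℓ₁ ℓ₂} (𝔽 : SizedField c ℓ₁ ℓ₂) : Set (lsuc (c ⊔ ℓ₁)) where
  field
    Instance : Set c
    encode   : Instance → Tree 𝔽
    Yes      : Instance → Set ℓ₁

infix 4 _≤ₚ_

_≤ₚ_ : ∀ {c ℓ₁ ℓ₂} {𝔽 : SizedField c ℓ₁ ℓ₂} → Problem 𝔽 → Problem 𝔽 → Set (c ⊔ ℓ₁)
_≤ₚ_ {𝔽 = 𝔽} A B =
  Σ (Prog 𝔽) λ p → ∃ λ k → ∀ (a : A.Instance) →
  Σ B.Instance λ b →
    (∃ λ t → (p ⊢ A.encode a ⇓ B.encode b [ t ]) × t ≤ poly k (size (A.encode a)))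
    × (A.Yes a ⇔ B.Yes b)
  where
  module A = Problem A
  module B = Problem B

-- A collection {D_t : t ∈ Fin sorts} of finite subsets of the field, each
-- listed without repetition.
record Domains {c ℓ₁ ℓ₂} (𝔽 : SizedField c ℓ₁ ℓ₂) : Set (c ⊔ ℓ₁) where
  open SizedField 𝔽 using (Carrier; _≈_)
  field
    sorts     : ℕ
    card      : Fin sorts → ℕ
    elem      : ∀ t → Fin (card t) → Carrier
    injective : ∀ t → Injective _≡_ _≈_ (elem t)

  Sort : Set
  Sort = Fin sorts

  Dom : Sort → Set
  Dom t = Fin (card t)

  -- Tuples in D_{t₁} × … × D_{tₘ}.
  Tuple : List Sort → Set
  Tuple = All Dom

  allTuples : ∀ ts → List (Tuple ts)
  allTuples []       = [] ∷ []
  allTuples (t ∷ ts) = cartesianProductWith _∷_ (allFin (card t)) (allTuples ts)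

module _ {c ℓ₁ ℓ₂} {𝔽 : SizedField c ℓ₁ ℓ₂} where
  open SizedField 𝔽 using (Carrier; _≈_; _+_; _*_; 0#; 1#)

  record Relation (𝒟 : Domains 𝔽) : Set where
    open Domains 𝒟
    field
      signature : List Sort
      holds     : Tuple signature → Bool

  open Relation public

  Language : Domains 𝔽 → Set → Set
  Language 𝒟 I = I → Relation 𝒟

  module _ {𝒟 : Domains 𝔽} where
    open Domains 𝒟

    -- A list of sorts X stands for variables x₀, …, xₙ₋₁ with δ(xᵢ) the i-th
    -- entry; an element of t ∈ X is a variable of sort t.

    atVars : ∀ {X ts} → Tuple X → All (_∈ X) ts → Tuple ts
    atVars φ = All.map (All.lookup φ)

    record Constraint {I : Set} (Γ : Language 𝒟 I) (X : List Sort) : Set where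
      field
        rel   : I
        scope : All (_∈ X) (signature (Γ rel))

    _⊨_ : ∀ {I} {Γ : Language 𝒟 I} {X} → Tuple X → Constraint Γ X → Set
    _⊨_ {Γ = Γ} φ C = T (holds (Γ rel) (atVars φ scope))
      where open Constraint C

    data Atom {I : Set} (Γ : Language 𝒟 I) (X : List Sort) : Set where
      constraint : Constraint Γ X → Atom Γ X
      equality   : ∀ {t} → t ∈ X → t ∈ X → Atom Γ X

    _⊨ₐ_ : ∀ {I} {Γ : Language 𝒟 I} {X} → Tuple X → Atom Γ X → Set
    φ ⊨ₐ constraint C = φ ⊨ C
    φ ⊨ₐ equality x y = All.lookup φ x ≡ All.lookup φ y

    PPDefines : ∀ {I} → Language 𝒟 I → ∀ {ts} → Pred (Tuple ts) 0ℓ → Set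
    PPDefines Γ {ts} P =
      Σ (List Sort) λ us → Σ (List (Atom Γ (ts ++ us))) λ L →
      ∀ (z : Tuple ts) → P z ⇔ (Σ (Tuple us) λ w → All ((z ++ᵗ w) ⊨ₐ_) L)

  record Interpretation (𝒟 ℰ : Domains 𝔽) : Set where
    private
      module D = Domains 𝒟
      module E = Domains ℰ
    field
      coords : E.Sort → List D.Sort
      F      : ∀ s → D.Tuple (coords s) → Bool

    Block : E.Sort → Set
    Block s = Σ (D.Tuple (coords s)) λ z → T (F s z)

    field
      π      : ∀ s → Block s → E.Dom s
      π-onto : ∀ s → StrictlySurjective _≡_ (π s)

    flatten : ∀ {ss} → All Block ss → D.Tuple (concatMap coords ss)
    flatten []             = []
    flatten ((z , _) ∷ zs) = z ++ᵗ flatten zs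

    Preimage : ∀ {ss} → Pred (E.Tuple ss) 0ℓ → Pred (D.Tuple (concatMap coords ss)) 0ℓ
    Preimage {ss} Q z =
      Σ (All Block ss) λ zs → flatten zs ≡ z × Q (All.map (λ {s} → π s) zs)

    Equal : ∀ s → Pred (E.Tuple (s ∷ s ∷ [])) 0ℓ
    Equal s (a ∷ b ∷ []) = a ≡ b

  -- Δ is finite; Γ is arbitrary.
  record PPInterprets {𝒟 ℰ : Domains 𝔽} {I J : Set}
                      (Γ : Language 𝒟 I) (Δ : Language ℰ J) : Set where
    field
      finite         : ∃ λ n → Fin n ↔ J
      interpretation : Interpretation 𝒟 ℰ
    open Interpretation interpretation public
    field
      defines-F   : ∀ s → PPDefines Γ (T ∘ F s)
      defines-≡   : ∀ s → PPDefines Γ (Preimage (Equal s))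
      defines-π⁻¹ : ∀ j → PPDefines Γ (Preimage (T ∘ holds (Δ j)))

  module _ {𝒟 : Domains 𝔽} where
    open Domains 𝒟

    Var : List Sort → Set
    Var X = ∃ λ t → t ∈ X

    -- A monomial is a product of variables, listed with multiplicity.
    Monomial : List Sort → Set
    Monomial X = List (Var X)

    -- A polynomial is presented as a sum of terms a·m; terms need not be
    -- collected.
    Polynomial : List Sort → Set c
    Polynomial X = List (Carrier × Monomial X)

    DegreeAtMost : ∀ {X} → ℕ → Polynomial X → Set c
    DegreeAtMost d = All (λ (_ , m) → length m ≤ d)

    evalMonomial : ∀ {X} → (Var X → Carrier) → Monomial X → Carrier
    evalMonomial ρ = foldr (λ x a → ρ x * a) 1#

    eval : ∀ {X} → (Var X → Carrier) → Polynomial X → Carrier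
    eval ρ = foldr (λ (a , m) b → a * evalMonomial ρ m + b) 0#

    point : ∀ {X} → Tuple X → Var X → Carrier
    point φ (t , x) = elem t (All.lookup φ x)

    -- The ideal of an instance is the vanishing ideal of its solution set.
    _∈Ideal_ : ∀ {I} {Γ : Language 𝒟 I} {X} → Polynomial X → List (Constraint Γ X) → Set ℓ₁
    f ∈Ideal 𝒞 = ∀ φ → All (φ ⊨_) 𝒞 → eval (point φ) f ≈ 0#

    -- Indices are encoded in unary; this is polynomially equivalent to binary
    -- because the sorts of all variables are listed in the input.
    encodeℕ : ℕ → Tree 𝔽
    encodeℕ zero    = nil
    encodeℕ (suc n) = cons nil (encodeℕ n)

    encodeList : ∀ {a} {A : Set a} → (A → Tree 𝔽) → List A → Tree 𝔽
    encodeList f = foldr (λ x → cons (f x)) nil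

    encodeAll : ∀ {a p} {A : Set a} {P : A → Set p} →
                (∀ {x} → P x → Tree 𝔽) → ∀ {xs} → All P xs → Tree 𝔽
    encodeAll f []       = nil
    encodeAll f (p ∷ ps) = cons (f p) (encodeAll f ps)

    encodeVar : ∀ {X : List Sort} {t} → t ∈ X → Tree 𝔽
    encodeVar x = encodeℕ (toℕ (index x))

    encodeSorts : List Sort → Tree 𝔽
    encodeSorts = encodeList (encodeℕ ∘ toℕ)

    encodeTuple : ∀ {ts} → Tuple ts → Tree 𝔽
    encodeTuple = encodeAll (λ {t} a → atom (elem t a))

    -- A relation is written out as its signature and the list of its tuples.
    encodeRelation : Relation 𝒟 → Tree 𝔽
    encodeRelation R =
      cons (encodeSorts (signature R))
           (encodeList encodeTuple (filterᵇ (holds R) (allTuples (signature R))))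

    encodeConstraint : ∀ {I} {Γ : Language 𝒟 I} {X} → Constraint Γ X → Tree 𝔽
    encodeConstraint {Γ = Γ} C = cons (encodeAll encodeVar scope) (encodeRelation (Γ rel))
      where open Constraint C

    encodePolynomial : ∀ {X} → Polynomial X → Tree 𝔽
    encodePolynomial =
      encodeList (λ (a , m) → cons (atom a) (encodeList (λ (_ , x) → encodeVar x) m))

    record IMPInstance {I : Set} (d : ℕ) (Γ : Language 𝒟 I) : Set c where
      field
        vars        : List Sort
        constraints : List (Constraint Γ vars)
        f           : Polynomial vars
        degree      : DegreeAtMost d f

    IMP : ∀ {I} → ℕ → Language 𝒟 I → Problem 𝔽
    IMP d Γ = record
      { Instance = IMPInstance d Γ
      ; encode   = λ P → let open IMPInstance P in
          cons (encodeSorts vars) (cons (encodeList encodeConstraint constraints) (encodePolynomial f))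
      ; Yes      = λ P → let open IMPInstance P in f ∈Ideal constraints
      }

-- Every variable of sort s is replaced by a block of variables for a point of
-- F_s, and every constraint Q by the pp-definition of π⁻¹(Q).  In the polynomial
-- a variable is replaced by the polynomial that interpolates π_s on F_s; its
-- degree does not depend on the instance, so the degree grows by a constant
-- factor K.  Since a monomial has at most d factors, multiplying out is
-- polynomial for fixed d.  Existential quantifiers become fresh variables.
-- Γ need not contain equality, so the equations of the pp-definitions are
-- removed by passing to representatives of the classes of variables that they
-- identify.  No step changes the values of the polynomial on the solution set,
-- hence none changes membership in the ideal.

module Submission where

open import Defs
open import Level using () renaming (_⊔_ to _⊔ˡ_)
open import Algebra.Bundles using (CommutativeRing)
open import Algebra.Apartness.Bundles using (HeytingCommutativeRing; HeytingField)
import Algebra.Properties.CommutativeSemigroup as CommutativeSemigroupProperties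
import Relation.Binary.Reasoning.Setoid as SetoidReasoning
open import Data.Bool.Base using (Bool; true; false; T)
open import Data.Bool.Properties using (T-irrelevant; T?)
open import Data.Empty using (⊥-elim)
open import Data.Fin.Base using (Fin; toℕ)
import Data.Fin.Properties as Fin
open import Data.List.Base
  using (List; []; _∷_; _++_; map; concat; concatMap; length; foldr; filterᵇ; allFin; tabulate)
import Data.List.Properties as List
open import Data.List.Membership.Propositional using (_∈_; mapWith∈)
open import Data.List.Membership.Propositional.Properties
  using (∈-++⁺ˡ; ∈-++⁺ʳ; ∈-allFin; ∈-cartesianProductWith⁺; ∈-filter⁺; ∈-filter⁻; ∈-map⁺; mapWith∈-cong; map-mapWith∈; mapWith∈≗map)
open import Data.List.Relation.Unary.All as All using (All; []; _∷_)
import Data.List.Relation.Unary.All.Properties as All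
open import Data.List.Relation.Unary.Any using (here; there; index)
open import Data.Nat.Base using (ℕ; zero; suc; _+_; _*_; _∸_; _^_; _⊔_; _≤_; z≤n; s≤s)
open import Data.Nat.Properties
open import Data.Nat.Tactic.RingSolver using (solve-∀)
open import Data.Product.Base using (Σ; ∃; _×_; _,_; proj₁; proj₂)
open import Data.Unit.Base using (tt)
open import Function.Base using (_∘_; id)
open import Function.Bundles using (_⇔_; mk⇔; Equivalence; Inverse)
open import Relation.Binary.PropositionalEquality
  using (_≡_; _≢_; refl; sym; trans; cong; cong₂; subst; module ≡-Reasoning)
open import Relation.Nullary using (¬_; yes; no)

-- Polynomial-time programs

-- The difficulty is cost rather than algebra. Iterating a polynomial-time step may square the size
-- in each round, so every loop needs a bound on its accumulator that holds throughout: steps that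
-- never enlarge the whole state, scans whose outputs depend on earlier inputs but not on earlier
-- outputs, and a table of representatives in which entries are only copied. Repeated products have
-- no such bound; they are unrolled d times, which is why d is fixed before the program is chosen.
-- Time and correctness are kept apart: a stage is a function on all trees, shown to be
-- polynomial-time by combinators, together with an identity saying that it commutes with the
-- encodings. `Γ` may be infinite, while constraints of `Δ` arrive as lists of tuples. Since `Δ` is
-- finite, its relations are recognized by comparison with constants of the program. Their
-- pp-definitions and the interpolation polynomials are constants as well, so the only arithmetic at
-- run time is the multiplication of coefficients.

^-distribʳ-* : ∀ k m n → (m * n) ^ k ≡ m ^ k * n ^ k
^-distribʳ-* zero    m n = refl
^-distribʳ-* (suc k) m n = begin
  m * n * (m * n) ^ k       ≡⟨ cong (m * n *_) (^-distribʳ-* k m n) ⟩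
  m * n * (m ^ k * n ^ k)   ≡⟨ [m*n]*[o*p]≡[m*o]*[n*p] m n (m ^ k) (n ^ k) ⟩
  m * m ^ k * (n * n ^ k)   ∎
  where open ≡-Reasoning

-- One number serves `poly` both as coefficient and as exponent, so the two are added up; the base
-- is positive, hence enlarging either is harmless.
monomial≤poly : ∀ a e n → a * suc n ^ e ≤ poly (a + e) n
monomial≤poly a e n = *-mono-≤ (m≤m+n a e) (^-monoʳ-≤ (suc n) (m≤n+m e a))

poly-mono : ∀ k {m n} → m ≤ n → poly k m ≤ poly k n
poly-mono k m≤n = *-monoʳ-≤ k (^-monoˡ-≤ k (s≤s m≤n))

poly-+ : ∀ j k n → poly j n + poly k n ≤ poly (j + k) n
poly-+ j k n = begin
  j * suc n ^ j + k * suc n ^ k             ≤⟨ +-mono-≤ (*-monoʳ-≤ j (^-monoʳ-≤ (suc n) (m≤m+n j k)))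
                                                        (*-monoʳ-≤ k (^-monoʳ-≤ (suc n) (m≤n+m k j))) ⟩
  j * suc n ^ (j + k) + k * suc n ^ (j + k) ≡⟨ *-distribʳ-+ (suc n ^ (j + k)) j k ⟨
  (j + k) * suc n ^ (j + k)                 ∎
  where open ≤-Reasoning

PolyBounded : (ℕ → ℕ) → Set
PolyBounded f = ∃ λ k → ∀ n → f n ≤ poly k n

poly-bounded : ∀ k → PolyBounded (poly k)
poly-bounded k = k , λ _ → ≤-refl

const-bounded : ∀ a → PolyBounded (λ _ → a)
const-bounded a = a + 0 , λ n → ≤-trans (≤-reflexive (sym (*-identityʳ a))) (monomial≤poly a 0 n)

id-bounded : PolyBounded (λ n → n)
id-bounded = 1 + 1 , λ n → ≤-trans (≤-trans (n≤1+n n) (≤-reflexive (lemma n))) (monomial≤poly 1 1 n)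
  where
  lemma : ∀ n → suc n ≡ 1 * (suc n * 1)
  lemma = solve-∀

+-bounded : ∀ {f g} → PolyBounded f → PolyBounded g → PolyBounded (λ n → f n + g n)
+-bounded (j , f≤) (k , g≤) = j + k , λ n → ≤-trans (+-mono-≤ (f≤ n) (g≤ n)) (poly-+ j k n)

*-bounded : ∀ {f g} → PolyBounded f → PolyBounded g → PolyBounded (λ n → f n * g n)
*-bounded {f} {g} (j , f≤) (k , g≤) = j * k + (j + k) , λ n → begin
  f n * g n                           ≤⟨ *-mono-≤ (f≤ n) (g≤ n) ⟩
  (j * suc n ^ j) * (k * suc n ^ k)   ≡⟨ [m*n]*[o*p]≡[m*o]*[n*p] j (suc n ^ j) k (suc n ^ k) ⟩
  (j * k) * (suc n ^ j * suc n ^ k)   ≡⟨ cong (j * k *_) (^-distribˡ-+-* (suc n) j k) ⟨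
  (j * k) * suc n ^ (j + k)           ≤⟨ monomial≤poly (j * k) (j + k) n ⟩
  poly (j * k + (j + k)) n            ∎
  where open ≤-Reasoning

-- The successor inside `poly k` is absorbed by `1 ≤ suc n ^ j`; then the power of a product splits.
∘-bounded : ∀ k {f} → PolyBounded f → PolyBounded (λ n → poly k (f n))
∘-bounded k {f} (j , f≤) = k * suc j ^ k + j * k , λ n → begin
  k * suc (f n) ^ k                  ≤⟨ *-monoʳ-≤ k (^-monoˡ-≤ k (s≤s (f≤ n))) ⟩
  k * (1 + j * suc n ^ j) ^ k        ≤⟨ *-monoʳ-≤ k (^-monoˡ-≤ k
                                          (+-monoˡ-≤ (j * suc n ^ j) (m^n>0 (suc n) j))) ⟩
  k * (suc j * suc n ^ j) ^ k        ≡⟨ cong (k *_) (^-distribʳ-* k (suc j) (suc n ^ j)) ⟩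
  k * (suc j ^ k * (suc n ^ j) ^ k)  ≡⟨ *-assoc k (suc j ^ k) ((suc n ^ j) ^ k) ⟨
  k * suc j ^ k * (suc n ^ j) ^ k    ≡⟨ cong (k * suc j ^ k *_) (^-*-assoc (suc n) j k) ⟩
  k * suc j ^ k * suc n ^ (j * k)    ≤⟨ monomial≤poly (k * suc j ^ k) (j * k) n ⟩
  poly (k * suc j ^ k + j * k) n     ∎
  where open ≤-Reasoning

module _ {c ℓ₁ ℓ₂} {𝔽 : SizedField c ℓ₁ ℓ₂} where

  hdT tlT : Tree 𝔽 → Tree 𝔽
  hdT = ⟦ hd ⟧
  tlT = ⟦ tl ⟧

  size-positive : ∀ (u : Tree 𝔽) → 1 ≤ size u
  size-positive nil        = ≤-refl
  size-positive (atom x)   = s≤s z≤n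
  size-positive (cons u v) = s≤s z≤n

  size-hd : ∀ u → size (hdT u) ≤ size u
  size-hd nil        = ≤-refl
  size-hd (atom x)   = s≤s z≤n
  size-hd (cons u v) = ≤-trans (m≤m+n (size u) (size v)) (n≤1+n _)

  size-tl : ∀ u → size (tlT u) ≤ size u
  size-tl nil        = ≤-refl
  size-tl (atom x)   = s≤s z≤n
  size-tl (cons u v) = ≤-trans (m≤n+m (size v) (size u)) (n≤1+n _)

  -- Every step pays for what it writes; the extra `cons` of `pair` is covered by the charge for its
  -- input, which has positive size. A time bound is thus also a bound on the result, and this is
  -- what composition needs.
  size≤time : ∀ {p : Prog 𝔽} {u v t} → p ⊢ u ⇓ v [ t ] → size v ≤ t
  size≤time {u = u} prim = m≤n+m _ (size u)
  size≤time (seq {s = s} _ q) = m≤n⇒m≤o+n s (size≤time q)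
  size≤time {u = u} (pair p q) = +-mono-≤ (size-positive u) (+-mono-≤ (size≤time p) (size≤time q))
  size≤time {u = u} (if-true {s = s} _ _ p) = m≤n⇒m≤o+n (size u) (m≤n⇒m≤o+n s (size≤time p))
  size≤time {u = u} (if-false {s = s} _ _ p) = m≤n⇒m≤o+n (size u) (m≤n⇒m≤o+n s (size≤time p))
  size≤time (while-false _ _) = m≤m+n _ _
  size≤time {u = u} (while-true {s = s} {t = t} _ _ _ p) =
    m≤n⇒m≤o+n (size u) (m≤n⇒m≤o+n s (m≤n⇒m≤o+n t (size≤time p)))

  infix 3 _⊢_⇓_within_

  _⊢_⇓_within_ : Prog 𝔽 → Tree 𝔽 → Tree 𝔽 → ℕ → Set c
  p ⊢ u ⇓ v within n = ∃ λ t → (p ⊢ u ⇓ v [ t ]) × t ≤ n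

  -- Polynomial-time computability of F from the presentation e of the arguments.
  record Computable {a} {A : Set a} (e F : A → Tree 𝔽) : Set (a ⊔ˡ c) where
    constructor computable
    field
      program : Prog 𝔽
      degree  : ℕ
      run     : ∀ x → program ⊢ e x ⇓ F x within poly degree (size (e x))

  PolyTime : (Tree 𝔽 → Tree 𝔽) → Set c
  PolyTime = Computable (λ u → u)

  -- The argument is taken apart by `hdT` and `tlT`, so that the function is total on trees, and on
  -- a `cons` both projections reduce by computation.
  record PolyTime₂ (g : Tree 𝔽 → Tree 𝔽 → Tree 𝔽) : Set c where
    constructor curried
    field uncurried : PolyTime (λ u → g (hdT u) (tlT u))

  module _ {a} {A : Set a} {e : A → Tree 𝔽} where

    computable-within : ∀ {F b} (p : Prog 𝔽) → PolyBounded b →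
                        (∀ x → p ⊢ e x ⇓ F x within b (size (e x))) → Computable e F
    computable-within p (k , b≤) r = computable p k λ x →
      let t , d , t≤ = r x in t , d , ≤-trans t≤ (b≤ (size (e x)))

    size-bound : ∀ {F} (C : Computable e F) x → size (F x) ≤ poly (Computable.degree C) (size (e x))
    size-bound C x = let _ , d , t≤ = Computable.run C x in ≤-trans (size≤time d) t≤

    computable-resp : ∀ {F G} → (∀ x → F x ≡ G x) → Computable e F → Computable e G
    computable-resp F≡G (computable p k r) = computable p k λ x →
      subst (λ v → p ⊢ e x ⇓ v within poly k (size (e x))) (F≡G x) (r x)

    basic : ∀ o {b} → PolyBounded b → (∀ x → size (⟦ o ⟧ (e x)) ≤ b (size (e x))) →
                Computable e (λ x → ⟦ o ⟧ (e x))
    basic o pb o≤ = computable-within (prim o) (+-bounded id-bounded pb) λ x →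
      _ , prim , +-monoʳ-≤ (size (e x)) (o≤ x)

    infixr 9 _▹_

    input : Computable e e
    input = basic ident id-bounded (λ _ → ≤-refl)

    constant : ∀ w → Computable e (λ _ → w)
    constant w = basic (const w) (const-bounded (size w)) (λ _ → ≤-refl)

    _▹_ : ∀ {F G} → Computable e F → Computable F G → Computable e G
    C ▹ D = computable-within (C.program ⨾ D.program)
      (+-bounded (poly-bounded C.degree) (∘-bounded D.degree (poly-bounded C.degree))) λ x →
      let _ , d , s≤ = C.run x
          _ , d′ , t≤ = D.run x
      in _ , seq d d′ , +-mono-≤ s≤ (≤-trans t≤ (poly-mono D.degree (size-bound C x)))
      where
      module C = Computable C
      module D = Computable D

    paired : ∀ {F G} → Computable e F → Computable e G → Computable e (λ x → cons (F x) (G x))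
    paired C D = computable-within (pair C.program D.program)
      (+-bounded id-bounded (+-bounded (poly-bounded C.degree) (poly-bounded D.degree))) λ x →
      let _ , d , s≤ = C.run x
          _ , d′ , t≤ = D.run x
      in _ , pair d d′ , +-monoʳ-≤ (size (e x)) (+-mono-≤ s≤ t≤)
      where
      module C = Computable C
      module D = Computable D

  module _ {a} {A : Set a} {e : A → Tree 𝔽} where

    apply : ∀ {f F} → PolyTime f → Computable e F → Computable e (λ x → f (F x))
    apply {F = F} (computable p k r) C = C ▹ computable p k (λ x → r (F x))

    apply₂ : ∀ {g F G} → PolyTime₂ g → Computable e F → Computable e G → Computable e (λ x → g (F x) (G x))
    apply₂ {F = F} {G = G} (curried P) C D = paired C D ▹ computable P.program P.degree (λ x → P.run (cons (F x) (G x)))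
      where module P = Computable P

    hdᶜ : ∀ {F} → Computable e F → Computable e (λ x → hdT (F x))
    hdᶜ C = apply (basic hd id-bounded size-hd) C

    tlᶜ : ∀ {F} → Computable e F → Computable e (λ x → tlT (F x))
    tlᶜ C = apply (basic tl id-bounded size-tl) C

  ifT : Tree 𝔽 → Tree 𝔽 → Tree 𝔽 → Tree 𝔽
  ifT b u v with truth b
  ... | true  = u
  ... | false = v

  ifT-true : ∀ {b : Tree 𝔽} {u v} → truth b ≡ true → ifT b u v ≡ u
  ifT-true eq rewrite eq = refl

  ifT-false : ∀ {b : Tree 𝔽} {u v} → truth b ≡ false → ifT b u v ≡ v
  ifT-false eq rewrite eq = refl

  module _ {a} {A : Set a} {e : A → Tree 𝔽} where

    ifᶜ : ∀ {B F G} → Computable e B → Computable e F → Computable e G → Computable e (λ x → ifT (B x) (F x) (G x))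
    ifᶜ {B} {F} {G} P C D = computable-within (if P.program then C.program else D.program)
      (+-bounded id-bounded (+-bounded (poly-bounded P.degree)
        (+-bounded (poly-bounded C.degree) (poly-bounded D.degree)))) branch
      where
      module P = Computable P
      module C = Computable C
      module D = Computable D
      branch : ∀ x → _ ⊢ e x ⇓ ifT (B x) (F x) (G x) within _
      branch x with P.run x | truth (B x) in eq
      ... | _ , d , r≤ | true =
        let _ , d′ , s≤ = C.run x
        in _ , if-true d eq d′ , +-monoʳ-≤ (size (e x)) (+-mono-≤ r≤ (≤-trans s≤ (m≤m+n _ _)))
      ... | _ , d , r≤ | false =
        let _ , d′ , s≤ = D.run x
        in _ , if-false d eq d′ , +-monoʳ-≤ (size (e x)) (+-mono-≤ r≤ (≤-trans s≤ (m≤n+m _ _)))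

  -- Iteration along a list with a bounded accumulator

  foldT : (Tree 𝔽 → Tree 𝔽) → Tree 𝔽 → Tree 𝔽 → Tree 𝔽
  foldT f (cons x xs) u = foldT f xs (f (cons x u))
  foldT f _           u = u

  -- All accumulators met on the way are bounded, since the cost of each round depends on the
  -- current one and a polynomial-time step alone gives no polynomial bound on its iterates.
  FoldBounded : (Tree 𝔽 → Tree 𝔽) → ℕ → Tree 𝔽 → Tree 𝔽 → Set
  FoldBounded f b (cons x xs) u = size u ≤ b × FoldBounded f b xs (f (cons x u))
  FoldBounded f b _           u = size u ≤ b

  module Loop {f : Tree 𝔽 → Tree 𝔽} (step : PolyTime f) where

    module S = Computable step

    -- The state is `cons L u`: the part of the list still to be read, and the accumulator.
    body loop : Prog 𝔽
    body = pair (prim hd ⨾ prim tl) (pair (prim hd ⨾ prim hd) (prim tl) ⨾ S.program)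
    loop = while prim hd run body

    -- 20 is a crude count of the steps of linear cost.
    round : ℕ → ℕ
    round n = 20 * n + poly S.degree n

    round-bounded : ∀ {g} → PolyBounded g → PolyBounded (λ n → round (g n))
    round-bounded pb = +-bounded (*-bounded (const-bounded 20) pb) (∘-bounded S.degree pb)

    -- The summands in front of t are the charge of the while rule and the cost of testing its
    -- guard, so that one `round` pays for a whole iteration on a state of size at most n.
    body-run : ∀ x xs u n → size (cons (cons x xs) u) ≤ n →
               ∃ λ t → (body ⊢ cons (cons x xs) u ⇓ cons xs (f (cons x u)) [ t ]) ×
                       size (cons (cons x xs) u) + (size (cons (cons x xs) u) + size (cons x xs) + t) ≤ round n
    body-run x xs u n s≤n = let t , d , t≤ = S.run (cons x u) in
      _ , pair (seq prim prim) (seq (pair (seq prim prim) prim) d) , (begin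
        _ ≤⟨ +-mono-≤ s≤n (+-mono-≤ (+-mono-≤ s≤n L≤) (+-mono-≤ s≤n (+-mono-≤
               (+-mono-≤ (+-mono-≤ s≤n L≤) (+-mono-≤ L≤ xs≤))
               (+-mono-≤ (+-mono-≤ s≤n (+-mono-≤ (+-mono-≤ (+-mono-≤ s≤n L≤) (+-mono-≤ L≤ x≤))
                                                 (+-mono-≤ s≤n u≤)))
                         (≤-trans t≤ (poly-mono S.degree xu≤)))))) ⟩
        n + (n + n + (n + ((n + n + (n + n)) + (n + (n + n + (n + n) + (n + n)) + poly S.degree n))))
          ≡⟨ lemma n (poly S.degree n) ⟩
        15 * n + poly S.degree n ≤⟨ +-monoˡ-≤ (poly S.degree n) (*-monoˡ-≤ n (m≤m+n 15 5)) ⟩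
        20 * n + poly S.degree n ∎)
      where
      open ≤-Reasoning
      lemma : ∀ n p → n + (n + n + (n + ((n + n + (n + n)) + (n + (n + n + (n + n) + (n + n)) + p)))) ≡ 15 * n + p
      lemma = solve-∀
      L≤ : size (cons x xs) ≤ n
      L≤ = ≤-trans (size-hd (cons (cons x xs) u)) s≤n
      u≤ : size u ≤ n
      u≤ = ≤-trans (size-tl (cons (cons x xs) u)) s≤n
      x≤ : size x ≤ n
      x≤ = ≤-trans (size-hd (cons x xs)) L≤
      xs≤ : size xs ≤ n
      xs≤ = ≤-trans (size-tl (cons x xs)) L≤
      xu≤ : size (cons x u) ≤ n
      xu≤ = ≤-trans (s≤s (+-monoˡ-≤ (size u) (≤-trans (m≤m+n (size x) (size xs)) (n≤1+n _)))) s≤n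

    stop : ∀ L u n → truth L ≡ false → size (cons L u) ≤ n →
           loop ⊢ cons L u ⇓ cons L u within size L * round n
    stop L u n eq s≤n = _ , while-false prim eq , (begin
      size (cons L u) + (size (cons L u) + size L)
        ≤⟨ +-mono-≤ s≤n (+-mono-≤ s≤n (≤-trans (size-hd (cons L u)) s≤n)) ⟩
      n + (n + n)                ≡⟨ lemma n ⟩
      3 * n                      ≤⟨ *-monoˡ-≤ n (m≤m+n 3 17) ⟩
      20 * n                     ≤⟨ m≤m+n (20 * n) _ ⟩
      round n                    ≡⟨ *-identityˡ (round n) ⟨
      1 * round n                ≤⟨ *-monoˡ-≤ (round n) (size-positive L) ⟩
      size L * round n           ∎)
      where
      open ≤-Reasoning
      lemma : ∀ n → n + (n + n) ≡ 3 * n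
      lemma = solve-∀

    -- `size L` bounds the number of guard tests, the failing one included, and no state is larger
    -- than `suc (m + b)`. The leftover `L′` is the last leaf of the list.
    loop-run : ∀ L u b m → size L ≤ m → FoldBounded f b L u →
               ∃ λ L′ → loop ⊢ cons L u ⇓ cons L′ (foldT f L u) within size L * round (suc (m + b))
    loop-run nil        u b m L≤ u≤ = nil , stop nil u _ refl (s≤s (+-mono-≤ L≤ u≤))
    loop-run (atom x)   u b m L≤ u≤ = atom x , stop (atom x) u _ refl (s≤s (+-mono-≤ L≤ u≤))
    loop-run (cons x xs) u b m L≤ (u≤ , bounded) =
      let _ , d , r≤ = body-run x xs u (suc (m + b)) (s≤s (+-mono-≤ L≤ u≤))
          L′ , _ , d′ , t≤ = loop-run xs (f (cons x u)) b m (≤-trans (size-tl (cons x xs)) L≤) bounded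
      in L′ , _ , while-true prim refl d d′ , (begin
           _ ≡⟨ lemma (size (cons (cons x xs) u)) (size (cons (cons x xs) u) + size (cons x xs)) _ _ ⟩
           _ ≤⟨ +-mono-≤ r≤ t≤ ⟩
           suc (size xs) * round (suc (m + b)) ≤⟨ *-monoˡ-≤ (round (suc (m + b))) (s≤s (m≤n+m (size xs) (size x))) ⟩
           size (cons x xs) * round (suc (m + b)) ∎)
      where
      open ≤-Reasoning
      lemma : ∀ s h t t′ → s + (h + (t + t′)) ≡ (s + (h + t)) + t′
      lemma = solve-∀

    size-result : ∀ L u b → FoldBounded f b L u → size (foldT f L u) ≤ b
    size-result nil         u b u≤ = u≤
    size-result (atom x)    u b u≤ = u≤
    size-result (cons x xs) u b (_ , bounded) = size-result xs _ b bounded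

    module _ {a} {A : Set a} {e : A → Tree 𝔽} where

      foldᶜ : ∀ {L U b} → Computable e L → Computable e U → PolyBounded b →
              (∀ x → FoldBounded f (b (size (e x))) (L x) (U x)) →
              Computable e (λ x → foldT f (L x) (U x))
      foldᶜ {L} {U} {b} C D pb bounded = computable-within ((CD.program ⨾ loop) ⨾ prim tl)
        (+-bounded (+-bounded (poly-bounded CD.degree) (*-bounded (poly-bounded CD.degree) (round-bounded n-bounded)))
                   (+-bounded (*-bounded (poly-bounded CD.degree) (round-bounded n-bounded)) pb)) λ x →
        let _ , d , s≤ = CD.run x
            L≤ = ≤-trans (size-hd (cons (L x) (U x))) (size-bound (paired C D) x)
            _ , _ , d′ , t≤ = loop-run (L x) (U x) _ _ L≤ (bounded x)
            t≤′ = ≤-trans t≤ (*-monoˡ-≤ _ L≤)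
        in _ , seq (seq d d′) prim , +-mono-≤ (+-mono-≤ s≤ t≤′)
             (+-mono-≤ (≤-trans (size≤time d′) t≤′) (size-result (L x) (U x) _ (bounded x)))
        where
        module CD = Computable (paired C D)
        n-bounded : PolyBounded (λ n → suc (poly CD.degree n + b n))
        n-bounded = +-bounded (const-bounded 1) (+-bounded (poly-bounded CD.degree) pb)

  open Loop public using (foldᶜ)

  module _ {f : Tree 𝔽 → Tree 𝔽} where

    NonExpansive : Set c
    NonExpansive = ∀ x u → size (f (cons x u)) ≤ size (cons x u)

    -- The size of the whole state is a potential: the accumulator gains at most the entry just
    -- consumed, together with its `cons`.
    nonExpansive⇒FoldBounded : NonExpansive → ∀ L u b → size (cons L u) ≤ b → FoldBounded f b L u
    nonExpansive⇒FoldBounded ne nil         u b s≤ = ≤-trans (size-tl (cons nil u)) s≤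
    nonExpansive⇒FoldBounded ne (atom x)    u b s≤ = ≤-trans (size-tl (cons (atom x) u)) s≤
    nonExpansive⇒FoldBounded ne (cons x xs) u b s≤ =
      ≤-trans (size-tl (cons (cons x xs) u)) s≤ ,
      nonExpansive⇒FoldBounded ne xs _ b (≤-trans
        (s≤s (≤-trans (+-monoʳ-≤ (size xs) (ne x u)) (≤-reflexive (lemma (size x) (size xs) (size u))))) s≤)
      where
      lemma : ∀ x xs u → xs + suc (x + u) ≡ suc (x + xs) + u
      lemma = solve-∀

    nonExpansiveFold : PolyTime f → NonExpansive → PolyTime₂ (foldT f)
    nonExpansiveFold step ne = curried (foldᶜ step (hdᶜ input) (tlᶜ input)
      (+-bounded (const-bounded 1) (+-bounded id-bounded id-bounded))
      λ u → nonExpansive⇒FoldBounded ne (hdT u) (tlT u) _ (s≤s (+-mono-≤ (size-hd u) (size-tl u))))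

-- List operations and unary arithmetic in polynomial time

module _ {c ℓ₁ ℓ₂} {𝔽 : SizedField c ℓ₁ ℓ₂} where

  open SizedField 𝔽 using (‖_‖; growth; *-growth; _#?_)

  -- Functions on lists; every tree is read as a list by ignoring its last leaf.

  foldrT : (Tree 𝔽 → Tree 𝔽) → Tree 𝔽 → Tree 𝔽 → Tree 𝔽
  foldrT f (cons x xs) u = f (cons x (foldrT f xs u))
  foldrT f _           u = u

  revOntoT : Tree 𝔽 → Tree 𝔽 → Tree 𝔽
  revOntoT = foldT (λ u → u)

  revOnto-polyTime : PolyTime₂ revOntoT
  revOnto-polyTime = nonExpansiveFold input (λ _ _ → ≤-refl)

  -- Loops are left folds; a right fold is run as a left fold over the reversal, which is the case
  -- where ys is `nil`. The general ys carries the induction.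
  fold-revOnto : ∀ f xs ys u → foldT f (revOntoT xs ys) u ≡ foldT f ys (foldrT f xs u)
  fold-revOnto f nil         ys u = refl
  fold-revOnto f (atom _)    ys u = refl
  fold-revOnto f (cons x xs) ys u = fold-revOnto f xs (cons x ys) u

  nonExpansiveFoldr : ∀ {f} → PolyTime f → NonExpansive {f = f} → PolyTime₂ (foldrT f)
  nonExpansiveFoldr {f} step ne = curried (computable-resp (λ u → fold-revOnto f (hdT u) nil (tlT u))
    (apply₂ (nonExpansiveFold step ne) (apply₂ revOnto-polyTime (hdᶜ input) (constant nil)) (tlᶜ input)))

  appendT : Tree 𝔽 → Tree 𝔽 → Tree 𝔽
  appendT = foldrT (λ u → u)

  append-polyTime : PolyTime₂ appendT
  append-polyTime = nonExpansiveFoldr input (λ _ _ → ≤-refl)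

  size-append : ∀ xs ys → size (appendT xs ys) ≤ size xs + size ys
  size-append nil         ys = n≤1+n _
  size-append (atom x)    ys = m≤n+m (size ys) _
  size-append (cons x xs) ys = s≤s (≤-trans (+-monoʳ-≤ (size x) (size-append xs ys))
                                            (≤-reflexive (sym (+-assoc (size x) (size xs) (size ys)))))

  concatT : Tree 𝔽 → Tree 𝔽
  concatT xss = foldrT (λ u → appendT (hdT u) (tlT u)) xss nil

  concat-polyTime : PolyTime concatT
  concat-polyTime = apply₂ (nonExpansiveFoldr (PolyTime₂.uncurried append-polyTime) (λ x u → ≤-trans (size-append x u) (n≤1+n _)))
                           input (constant nil)

  dropT : Tree 𝔽 → Tree 𝔽 → Tree 𝔽
  dropT = foldT (λ u → tlT (tlT u))

  drop-polyTime : PolyTime₂ dropT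
  drop-polyTime = nonExpansiveFold (tlᶜ (tlᶜ input))
    (λ x u → ≤-trans (size-tl u) (size-tl (cons x u)))

  nthT : Tree 𝔽 → Tree 𝔽 → Tree 𝔽
  nthT xs i = hdT (dropT i xs)

  nth-polyTime : PolyTime₂ nthT
  nth-polyTime = curried (hdᶜ (apply₂ drop-polyTime (tlᶜ input) (hdᶜ input)))

  -- On unary numbers `dropT m n` is the truncated difference `n ∸ m`, so equality means that both
  -- differences vanish.
  eqT : Tree 𝔽 → Tree 𝔽 → Tree 𝔽
  eqT m n = ifT (dropT m n) nil (ifT (dropT n m) nil (cons nil nil))

  eq-polyTime : PolyTime₂ eqT
  eq-polyTime = curried (ifᶜ (apply₂ drop-polyTime (hdᶜ input) (tlᶜ input)) (constant nil)
    (ifᶜ (apply₂ drop-polyTime (tlᶜ input) (hdᶜ input)) (constant nil) (constant (cons nil nil))))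

  mulT : Tree 𝔽 → Tree 𝔽 → Tree 𝔽
  mulT u v = ⟦ mul ⟧ (cons u v)

  -- The only arithmetic that the reduction performs on field elements; `*-growth` keeps its result
  -- polynomial in size.
  mul-polyTime : PolyTime₂ mulT
  mul-polyTime = curried (apply (basic mul (+-bounded (const-bounded 1) (poly-bounded growth)) bound)
                       (paired (hdᶜ input) (tlᶜ input)))
    where
    bound : ∀ (u : Tree 𝔽) → size (⟦ mul ⟧ u) ≤ 1 + poly growth (size u)
    bound nil                      = s≤s z≤n
    bound (atom _)                 = s≤s z≤n
    bound (cons nil _)             = s≤s z≤n
    bound (cons (cons _ _) _)      = s≤s z≤n
    bound (cons (atom _) nil)      = s≤s z≤n
    bound (cons (atom _) (cons _ _)) = s≤s z≤n
    bound (cons (atom x) (atom y)) = s≤s (≤-trans (*-growth x y) (poly-mono growth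
      (m≤n⇒m≤1+n (+-mono-≤ (n≤1+n ‖ x ‖) (n≤1+n ‖ y ‖)))))

  equal-polyTime : PolyTime ⟦ equal ⟧
  equal-polyTime = basic equal (const-bounded 3) bound
    where
    bound : ∀ (u : Tree 𝔽) → size (⟦ equal ⟧ u) ≤ 3
    bound nil                      = s≤s z≤n
    bound (atom _)                 = s≤s z≤n
    bound (cons nil _)             = s≤s z≤n
    bound (cons (cons _ _) _)      = s≤s z≤n
    bound (cons (atom _) nil)      = s≤s z≤n
    bound (cons (atom _) (cons _ _)) = s≤s z≤n
    bound (cons (atom x) (atom y)) with x #? y
    ... | yes _ = s≤s z≤n
    ... | no  _ = ≤-refl

  record PolyTime₃ (g : Tree 𝔽 → Tree 𝔽 → Tree 𝔽 → Tree 𝔽) : Set c where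
    constructor curried
    field uncurried : PolyTime (λ u → g (hdT u) (hdT (tlT u)) (tlT (tlT u)))

  -- The i-th entry of the result may depend on the reversed list of the entries before it.
  scanT : (Tree 𝔽 → Tree 𝔽 → Tree 𝔽 → Tree 𝔽) → Tree 𝔽 → Tree 𝔽 → Tree 𝔽 → Tree 𝔽
  scanT g w pre (cons x xs) = cons (g w pre x) (scanT g w (cons x pre) xs)
  scanT g w pre _           = nil

  module Scan (g : Tree 𝔽 → Tree 𝔽 → Tree 𝔽 → Tree 𝔽) (g-polyTime : PolyTime₃ g) where

    k : ℕ
    k = Computable.degree (PolyTime₃.uncurried g-polyTime)

    -- The state is `cons w (cons pre out)`: the parameter, the reversed inputs read so far, and the
    -- reversed outputs.
    step : Tree 𝔽 → Tree 𝔽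
    step u = cons (hdT (tlT u)) (cons (cons (hdT u) (hdT (tlT (tlT u))))
      (cons (g (hdT (tlT u)) (hdT (tlT (tlT u))) (hdT u)) (tlT (tlT (tlT u)))))

    step-polyTime : PolyTime step
    step-polyTime = paired w (paired (paired x pre)
      (paired (apply (PolyTime₃.uncurried g-polyTime) (paired w (paired pre x))) (tlᶜ (tlᶜ (tlᶜ input)))))
      where
      x : PolyTime hdT
      x = hdᶜ input
      w : PolyTime (λ u → hdT (tlT u))
      w = hdᶜ (tlᶜ input)
      pre : PolyTime (λ u → hdT (tlT (tlT u)))
      pre = hdᶜ (tlᶜ (tlᶜ input))

    fold-step : ∀ w pre xs out → foldT step xs (cons w (cons pre out)) ≡
                cons w (cons (revOntoT xs pre) (revOntoT (scanT g w pre xs) out))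
    fold-step w pre nil         out = refl
    fold-step w pre (atom _)    out = refl
    fold-step w pre (cons x xs) out = fold-step w (cons x pre) xs (cons (g w pre x) out)

    -- The outputs are collected in reverse and reversed at the end. Two reversals replace the last
    -- leaf by `nil`, which is what a scan ends in anyway.
    scan-proper : ∀ w pre xs → appendT (scanT g w pre xs) nil ≡ scanT g w pre xs
    scan-proper w pre nil         = refl
    scan-proper w pre (atom _)    = refl
    scan-proper w pre (cons x xs) = cong (cons (g w pre x)) (scan-proper w (cons x pre) xs)

    entry : ℕ → ℕ → ℕ
    entry W P = poly k (2 + (W + P))

    state-bounded : ∀ W P O (w pre out xs : Tree 𝔽) → size w ≤ W → size xs + size pre ≤ P →
                    size out + size xs * suc (entry W P) ≤ O →
                    size (cons w (cons pre out)) ≤ 2 + (W + (P + O))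
    state-bounded W P O w pre out xs w≤ p≤ o≤ = s≤s (≤-trans
      (+-mono-≤ w≤ (s≤s (+-mono-≤ (≤-trans (m≤n+m _ (size xs)) p≤) (≤-trans (m≤m+n (size out) _) o≤))))
      (≤-reflexive (+-suc W (P + O))))

    -- The step does enlarge the state, but two potentials never increase: `size xs + size pre`,
    -- because an entry only moves to the prefix, and `size out` plus a reserve of `suc (entry W P)`
    -- for each unit of xs, which pays for the next output and its `cons`. The first keeps every
    -- output below `entry W P`, however many came before.
    fold-bounded : ∀ W P O (w pre out xs : Tree 𝔽) → size w ≤ W → size xs + size pre ≤ P →
                   size out + size xs * suc (entry W P) ≤ O →
                   FoldBounded step (2 + (W + (P + O))) xs (cons w (cons pre out))
    fold-bounded W P O w pre out nil        w≤ p≤ o≤ = state-bounded W P O w pre out nil w≤ p≤ o≤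
    fold-bounded W P O w pre out (atom x)   w≤ p≤ o≤ = state-bounded W P O w pre out (atom x) w≤ p≤ o≤
    fold-bounded W P O w pre out (cons x xs) w≤ p≤ o≤ =
      state-bounded W P O w pre out (cons x xs) w≤ p≤ o≤ ,
      fold-bounded W P O w (cons x pre) (cons (g w pre x) out) xs w≤
        (≤-trans (≤-reflexive (lemma (size x) (size xs) (size pre))) p≤)
        (begin
          suc (size (g w pre x) + size out) + size xs * suc E
            ≤⟨ s≤s (+-monoˡ-≤ _ (+-monoˡ-≤ (size out) g≤)) ⟩
          suc (E + size out) + size xs * suc E
            ≡⟨ lemma′ E (size out) (size xs) ⟩
          size out + suc (size xs) * suc E
            ≤⟨ +-monoʳ-≤ (size out) (*-monoˡ-≤ (suc E) (s≤s (m≤n+m (size xs) (size x)))) ⟩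
          size out + size (cons x xs) * suc E
            ≤⟨ o≤ ⟩
          O ∎)
      where
      open ≤-Reasoning
      E : ℕ
      E = entry W P
      lemma : ∀ x xs p → xs + suc (x + p) ≡ suc (x + xs) + p
      lemma = solve-∀
      lemma′ : ∀ e o s → suc (e + o) + s * suc e ≡ o + suc s * suc e
      lemma′ = solve-∀
      lemma″ : ∀ w p x → suc (w + suc (p + x)) ≡ 2 + (w + (x + p))
      lemma″ = solve-∀
      g≤ : size (g w pre x) ≤ E
      g≤ = ≤-trans (size-bound (PolyTime₃.uncurried g-polyTime) (cons w (cons pre x))) (poly-mono k (begin
        suc (size w + suc (size pre + size x)) ≡⟨ lemma″ (size w) (size pre) (size x) ⟩
        2 + (size w + (size x + size pre)) ≤⟨ s≤s (s≤s (+-mono-≤ w≤ (≤-trans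
            (+-monoˡ-≤ (size pre) (≤-trans (m≤m+n (size x) (size xs)) (n≤1+n _))) p≤))) ⟩
        2 + (W + P) ∎))

    scan-polyTime : PolyTime₃ (scanT g)
    scan-polyTime = curried (computable-resp (λ u → trans
        (cong (λ v → revOntoT (tlT (tlT v)) nil) (fold-step (hdT u) (hdT (tlT u)) (tlT (tlT u)) nil))
        (trans (fold-revOnto (λ v → v) (scanT g (hdT u) (hdT (tlT u)) (tlT (tlT u))) nil nil)
               (scan-proper (hdT u) (hdT (tlT u)) (tlT (tlT u)))))
      (apply₂ revOnto-polyTime (tlᶜ (tlᶜ (foldᶜ step-polyTime (tlᶜ (tlᶜ input))
        (paired (hdᶜ input) (paired (hdᶜ (tlᶜ input)) (constant nil))) B-bounded bounded))) (constant nil)))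
      where
      -- Here W is n, P is n + n and O is 1 + n * suc (entry W P); the 1 is the size of the empty
      -- output.
      B : ℕ → ℕ
      B n = 2 + (n + ((n + n) + (1 + n * suc (poly k (2 + (n + (n + n)))))))
      2n : PolyBounded (λ n → n + n)
      2n = +-bounded id-bounded id-bounded
      B-bounded : PolyBounded B
      B-bounded = +-bounded (const-bounded 2) (+-bounded id-bounded (+-bounded 2n (+-bounded (const-bounded 1)
        (*-bounded id-bounded (+-bounded (const-bounded 1)
          (∘-bounded k (+-bounded (const-bounded 2) (+-bounded id-bounded 2n))))))))
      bounded : ∀ u → FoldBounded step (B (size u)) (tlT (tlT u)) (cons (hdT u) (cons (hdT (tlT u)) nil))
      bounded u = fold-bounded (size u) (size u + size u) _ (hdT u) (hdT (tlT u)) nil (tlT (tlT u)) (size-hd u)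
        (+-mono-≤ xs≤ (≤-trans (size-hd (tlT u)) (size-tl u)))
        (s≤s (*-monoˡ-≤ (suc (entry (size u) (size u + size u))) xs≤))
        where
        xs≤ : size (tlT (tlT u)) ≤ size u
        xs≤ = ≤-trans (size-tl (tlT u)) (size-tl u)

  mapT : (Tree 𝔽 → Tree 𝔽 → Tree 𝔽) → Tree 𝔽 → Tree 𝔽 → Tree 𝔽
  mapT g w (cons x xs) = cons (g w x) (mapT g w xs)
  mapT g w _           = nil

  map-polyTime : ∀ {g} → PolyTime₂ g → PolyTime₂ (mapT g)
  map-polyTime {g} P = curried (computable-resp (λ u → scan≡map (hdT u) nil (tlT u))
    (apply (PolyTime₃.uncurried (Scan.scan-polyTime (λ w _ x → g w x) (curried (apply₂ P (hdᶜ input) (tlᶜ (tlᶜ input))))))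
           (paired (hdᶜ input) (paired (constant nil) (tlᶜ input)))))
    where
    scan≡map : ∀ w pre xs → scanT (λ w _ x → g w x) w pre xs ≡ mapT g w xs
    scan≡map w pre nil         = refl
    scan≡map w pre (atom _)    = refl
    scan≡map w pre (cons x xs) = cong (cons (g w x)) (scan≡map w (cons x pre) xs)

  module _ {a} {A : Set a} {e : A → Tree 𝔽} where

    mapᶜ : ∀ {g W L} → PolyTime₂ g → Computable e W → Computable e L → Computable e (λ x → mapT g (W x) (L x))
    mapᶜ P = apply₂ (map-polyTime P)

    scanᶜ : ∀ {g W L} → PolyTime₃ g → Computable e W → Computable e L → Computable e (λ x → scanT g (W x) nil (L x))
    scanᶜ {g} P C D = apply (PolyTime₃.uncurried (Scan.scan-polyTime g P)) (paired C (paired (constant nil) D))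

  -- A unary number is a list of `nil`s, so a length is a map.
  lengthT : Tree 𝔽 → Tree 𝔽
  lengthT = mapT (λ _ _ → nil) nil

  length-polyTime : PolyTime lengthT
  length-polyTime = mapᶜ (curried (constant nil)) (constant nil) input

  ⟨_⟩ : List (Tree 𝔽) → Tree 𝔽
  ⟨ [] ⟩     = nil
  ⟨ u ∷ us ⟩ = cons u ⟨ us ⟩

  unary : ℕ → Tree 𝔽
  unary zero    = nil
  unary (suc n) = cons nil (unary n)

  map-⟨⟩ : ∀ g w us → mapT g w ⟨ us ⟩ ≡ ⟨ map (g w) us ⟩
  map-⟨⟩ g w []       = refl
  map-⟨⟩ g w (u ∷ us) = cong (cons (g w u)) (map-⟨⟩ g w us)

  append-⟨⟩ : ∀ us vs → appendT ⟨ us ⟩ ⟨ vs ⟩ ≡ ⟨ us ++ vs ⟩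
  append-⟨⟩ []       vs = refl
  append-⟨⟩ (u ∷ us) vs = cong (cons u) (append-⟨⟩ us vs)

  length-⟨⟩ : ∀ us → lengthT ⟨ us ⟩ ≡ unary (length us)
  length-⟨⟩ []       = refl
  length-⟨⟩ (u ∷ us) = cong (cons nil) (length-⟨⟩ us)

  append-unary : ∀ m n → appendT (unary m) (unary n) ≡ unary (m + n)
  append-unary zero    n = refl
  append-unary (suc m) n = cong (cons nil) (append-unary m n)

  drop-unary : ∀ m n → dropT (unary m) (unary n) ≡ unary (n ∸ m)
  drop-unary zero    n       = refl
  drop-unary (suc m) zero    = trans (drop-unary m zero) (cong unary (0∸n≡0 m))
  drop-unary (suc m) (suc n) = drop-unary m n

  truth-eq⁺ : ∀ n → truth (eqT (unary n) (unary n)) ≡ true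
  truth-eq⁺ n rewrite drop-unary n n | n∸n≡0 n = refl

  truth-eq⁻ : ∀ m n → truth (eqT (unary m) (unary n)) ≡ true → m ≡ n
  truth-eq⁻ m n eq rewrite drop-unary m n | drop-unary n m with n ∸ m in p | m ∸ n in q
  ... | zero | zero = ≤-antisym (m∸n≡0⇒m≤n q) (m∸n≡0⇒m≤n p)

-- Renaming variables

module _ {a} {A : Set a} where

  idx : ∀ {x : A} {xs} → x ∈ xs → ℕ
  idx x = toℕ (index x)

  idx-++⁺ˡ : ∀ {x : A} {xs ys} (p : x ∈ xs) → idx (∈-++⁺ˡ {ys = ys} p) ≡ idx p
  idx-++⁺ˡ (here refl) = refl
  idx-++⁺ˡ (there p)   = cong suc (idx-++⁺ˡ p)

  idx-++⁺ʳ : ∀ {x : A} xs {ys} (p : x ∈ ys) → idx (∈-++⁺ʳ xs p) ≡ length xs + idx p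
  idx-++⁺ʳ []       p = refl
  idx-++⁺ʳ (_ ∷ xs) p = cong suc (idx-++⁺ʳ xs p)

  -- Codes of variables are bare positions and carry no sort. A position in xs determines the sort
  -- as well, so comparing codes is enough.
  idx-injective : ∀ {x y : A} {xs} (p : x ∈ xs) (q : y ∈ xs) → idx p ≡ idx q →
                  Σ (x ≡ y) λ eq → subst (_∈ xs) eq p ≡ q
  idx-injective (here refl) (here refl) _  = refl , refl
  idx-injective (there p)   (there q)   eq with idx-injective p q (suc-injective eq)
  ... | refl , refl = refl , refl

  module _ {p} {P : A → Set p} where

    lookup-tabulate : ∀ {xs} (f : ∀ {x} → x ∈ xs → P x) {x} (i : x ∈ xs) → All.lookup (All.tabulate f) i ≡ f i
    lookup-tabulate f (here refl) = refl
    lookup-tabulate f (there i)   = lookup-tabulate (f ∘ there) i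

    lookup-++⁺ˡ : ∀ {xs ys} (ps : All P xs) (qs : All P ys) {x} (i : x ∈ xs) →
                  All.lookup (All.++⁺ ps qs) (∈-++⁺ˡ i) ≡ All.lookup ps i
    lookup-++⁺ˡ (p ∷ ps) qs (here refl) = refl
    lookup-++⁺ˡ (p ∷ ps) qs (there i)   = lookup-++⁺ˡ ps qs i

    lookup-++⁺ʳ : ∀ {xs ys} (ps : All P xs) (qs : All P ys) {x} (i : x ∈ ys) →
                  All.lookup (All.++⁺ ps qs) (∈-++⁺ʳ xs i) ≡ All.lookup qs i
    lookup-++⁺ʳ []       qs i = refl
    lookup-++⁺ʳ (p ∷ ps) qs i = lookup-++⁺ʳ ps qs i

    lookup-extensional : ∀ {xs} (ps qs : All P xs) → (∀ {x} (i : x ∈ xs) → All.lookup ps i ≡ All.lookup qs i) → ps ≡ qs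
    lookup-extensional []       []       eq = refl
    lookup-extensional (p ∷ ps) (q ∷ qs) eq = cong₂ _∷_ (eq (here refl)) (lookup-extensional ps qs (eq ∘ there))

    ++⁺-injective : ∀ {xs ys} (ps ps′ : All P xs) {qs qs′ : All P ys} →
                    All.++⁺ ps qs ≡ All.++⁺ ps′ qs′ → ps ≡ ps′ × qs ≡ qs′
    ++⁺-injective []       []        eq = refl , eq
    ++⁺-injective (p ∷ ps) (_ ∷ ps′) eq with ++⁺-injective ps ps′ (cong (λ { (_ ∷ rs) → rs }) eq)
    ... | refl , eq′ = cong (λ { (r ∷ _) → r ∷ ps }) eq , eq′

    reduce-++⁺ : ∀ {b} {B : Set b} (f : ∀ {x} → P x → B) {xs ys} (ps : All P xs) (qs : All P ys) →
                 All.reduce f (All.++⁺ ps qs) ≡ All.reduce f ps ++ All.reduce f qs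
    reduce-++⁺ f []       qs = refl
    reduce-++⁺ f (p ∷ ps) qs = cong (f p ∷_) (reduce-++⁺ f ps qs)

    reduce-tabulate : ∀ {b} {B : Set b} (f : ∀ {x} → P x → B) {xs} (g : ∀ {x} → x ∈ xs → P x) →
                      All.reduce f (All.tabulate g) ≡ mapWith∈ xs (λ i → f (g i))
    reduce-tabulate f {[]}     g = refl
    reduce-tabulate f {x ∷ xs} g = cong (f (g (here refl)) ∷_) (reduce-tabulate f (g ∘ there))

    reduce-map : ∀ {q b} {Q : A → Set q} {B : Set b} (f : ∀ {x} → Q x → B) (g : ∀ {x} → P x → Q x)
                 {xs} (ps : All P xs) → All.reduce f (All.map g ps) ≡ All.reduce (λ p → f (g p)) ps
    reduce-map f g []       = refl
    reduce-map f g (p ∷ ps) = cong (f (g p) ∷_) (reduce-map f g ps)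

    reduce-cong : ∀ {b} {B : Set b} {f g : ∀ {x} → P x → B} → (∀ {x} (p : P x) → f p ≡ g p) →
                  ∀ {xs} (ps : All P xs) → All.reduce f ps ≡ All.reduce g ps
    reduce-cong f≡g []       = refl
    reduce-cong f≡g (p ∷ ps) = cong₂ _∷_ (f≡g p) (reduce-cong f≡g ps)

    map-reduce : ∀ {b d} {B : Set b} {D : Set d} (g : B → D) (f : ∀ {x} → P x → B) {xs} (ps : All P xs) →
                 map g (All.reduce f ps) ≡ All.reduce (λ p → g (f p)) ps
    map-reduce g f []       = refl
    map-reduce g f (p ∷ ps) = cong (g (f p) ∷_) (map-reduce g f ps)

module _ {a b} {A : Set a} {B : Set b} (f : A → List B) where

  ∈-block : ∀ {x xs y} → x ∈ xs → y ∈ f x → y ∈ concatMap f xs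
  ∈-block (here refl)           v = ∈-++⁺ˡ v
  ∈-block {xs = z ∷ _} (there x) v = ∈-++⁺ʳ (f z) (∈-block x v)

  module _ {p} {P : B → Set p} where

    flat : ∀ {xs} → All (λ x → All P (f x)) xs → All P (concatMap f xs)
    flat []         = []
    flat (ps ∷ pss) = All.++⁺ ps (flat pss)

    lookup-flat : ∀ {xs} (pss : All (λ x → All P (f x)) xs) {x} (i : x ∈ xs) {y} (v : y ∈ f x) →
                  All.lookup (flat pss) (∈-block i v) ≡ All.lookup (All.lookup pss i) v
    lookup-flat (ps ∷ pss) (here refl) v = lookup-++⁺ˡ ps (flat pss) v
    lookup-flat (ps ∷ pss) (there i)   v = trans (lookup-++⁺ʳ ps (flat pss) _) (lookup-flat pss i v)

Ren : ∀ {a} {A : Set a} → List A → List A → Set a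
Ren X Y = ∀ {t} → t ∈ X → t ∈ Y

module _ {c ℓ₁ ℓ₂} {𝔽 : SizedField c ℓ₁ ℓ₂} where

  module _ {a} {A : Set a} where

    var : ∀ {x : A} {xs} → x ∈ xs → Tree 𝔽
    var x = unary (idx x)

    nth-reduce : ∀ {p} {P : A → Set p} (f : ∀ {x} → P x → Tree 𝔽) {xs} (ps : All P xs) {x} (i : x ∈ xs) →
                 nthT ⟨ All.reduce f ps ⟩ (var i) ≡ f (All.lookup ps i)
    nth-reduce f (p ∷ ps) (here refl) = refl
    nth-reduce f (p ∷ ps) (there i)   = nth-reduce f ps i

    nth-mapWith∈ : ∀ {xs} (f : ∀ {x} → x ∈ xs → Tree 𝔽) {x} (i : x ∈ xs) → nthT ⟨ mapWith∈ xs f ⟩ (var i) ≡ f i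
    nth-mapWith∈ f (here refl) = refl
    nth-mapWith∈ f (there i)   = nth-mapWith∈ (f ∘ there) i

    table : ∀ {X Y} → Ren {A = A} X Y → Tree 𝔽
    table {X} ρ = ⟨ mapWith∈ X (λ x → var (ρ x)) ⟩

    range : List A → Tree 𝔽
    range X = table {X} (λ x → x)

    length-range : ∀ X → lengthT (range X) ≡ unary (length X)
    length-range X = trans (length-⟨⟩ _) (cong unary (length-mapWith∈ X var))
      where
      length-mapWith∈ : ∀ (xs : List A) (f : ∀ {x} → x ∈ xs → Tree 𝔽) → length (mapWith∈ xs f) ≡ length xs
      length-mapWith∈ []       f = refl
      length-mapWith∈ (x ∷ xs) f = cong suc (length-mapWith∈ xs (f ∘ there))

    varsCode : ∀ {X ts : List A} → All (_∈ X) ts → Tree 𝔽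
    varsCode V = ⟨ All.reduce var V ⟩

    -- Only the outcome of lookups matters. Both a `table` and the code of a scope qualify, so one
    -- renaming program serves for representatives as well as for the arguments of a formula.
    Represents : Tree 𝔽 → ∀ {X Y} → Ren {A = A} X Y → Set (a ⊔ˡ c)
    Represents V {X} ρ = ∀ {t} (x : t ∈ X) → nthT V (var x) ≡ var (ρ x)

    vars-represents : ∀ {X Y : List A} (V : All (_∈ Y) X) → Represents (varsCode V) (All.lookup V)
    vars-represents V = nth-reduce var V

    renVars : ∀ {V X Y} {ρ : Ren X Y} → Represents V ρ → ∀ {ts} (W : All (_∈ X) ts) →
              mapT nthT V (varsCode W) ≡ varsCode (All.map ρ W)
    renVars {V} {ρ = ρ} V≈ρ W = trans (map-⟨⟩ nthT V (All.reduce var W)) (cong ⟨_⟩ (begin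
      map (nthT V) (All.reduce var W)      ≡⟨ map-reduce (nthT V) var W ⟩
      All.reduce (λ x → nthT V (var x)) W  ≡⟨ reduce-cong V≈ρ W ⟩
      All.reduce (λ x → var (ρ x)) W       ≡⟨ reduce-map var ρ W ⟨
      All.reduce var (All.map ρ W)         ∎))
      where open ≡-Reasoning

  -- Concatenating unary numbers adds them: this is base plus the total length of the blocks already
  -- passed, recomputed from the prefix of the scan.
  offsetT : Tree 𝔽 → Tree 𝔽 → Tree 𝔽
  offsetT base pre = appendT base (concatT (mapT (λ _ u → lengthT (hdT u)) nil pre))

  placeT : Tree 𝔽 → Tree 𝔽 → Tree 𝔽 → Tree 𝔽
  placeT base pre u = cons (mapT appendT (offsetT base pre) (hdT u)) (tlT u)

  -- Lays out blocks of variables consecutively from index base on.  A block is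
  -- given as cons (range X) w, w being data that is carried along.
  layoutT : Tree 𝔽 → Tree 𝔽 → Tree 𝔽
  layoutT base = scanT placeT base nil

  layoutᶜ : ∀ {a} {A : Set a} {e B L : A → Tree 𝔽} → Computable e B → Computable e L →
            Computable e (λ x → layoutT (B x) (L x))
  layoutᶜ = scanᶜ (curried (paired
    (mapᶜ append-polyTime
      (apply₂ append-polyTime (hdᶜ input)
        (apply concat-polyTime (mapᶜ (curried (apply length-polyTime (hdᶜ (tlᶜ input)))) (constant nil) (hdᶜ (tlᶜ input)))))
      (hdᶜ (tlᶜ (tlᶜ input))))
    (tlᶜ (tlᶜ (tlᶜ input)))))

  module _ {a b} {A : Set a} {B : Set b} (f : A → List B) (w : A → Tree 𝔽) where

    -- Here n is the number of variables in the blocks already placed. Passing to the tail moves the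
    -- length of the first block from the index within the tail into n.
    layout-from : ∀ m n pre → concatT (mapT (λ _ u → lengthT (hdT u)) nil pre) ≡ unary n → ∀ xs →
      scanT placeT (unary m) pre ⟨ map (λ x → cons (range (f x)) (w x)) xs ⟩ ≡
      ⟨ mapWith∈ xs (λ {x} i → cons ⟨ mapWith∈ (f x) (λ v → unary (m + n + idx (∈-block f i v))) ⟩ (w x)) ⟩
    layout-from m n pre eq []       = refl
    layout-from m n pre eq (x ∷ xs) = cong₂ cons
      (cong (λ u → cons u (w x)) (begin
        mapT appendT (offsetT (unary m) pre) (range (f x))
          ≡⟨ cong (λ u → mapT appendT u (range (f x))) (trans (cong (appendT (unary m)) eq) (append-unary m n)) ⟩
        mapT appendT (unary (m + n)) (range (f x))
          ≡⟨ map-⟨⟩ appendT (unary (m + n)) _ ⟩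
        ⟨ map (appendT (unary (m + n))) (mapWith∈ (f x) var) ⟩
          ≡⟨ cong ⟨_⟩ (map-mapWith∈ (f x) var (appendT (unary (m + n)))) ⟩
        ⟨ mapWith∈ (f x) (λ v → appendT (unary (m + n)) (var v)) ⟩
          ≡⟨ cong ⟨_⟩ (mapWith∈-cong (f x) _ _ (λ v → trans (append-unary (m + n) (idx v))
               (cong (λ i → unary (m + n + i)) (sym (idx-++⁺ˡ v))))) ⟩
        ⟨ mapWith∈ (f x) (λ v → unary (m + n + idx (∈-++⁺ˡ {ys = concatMap f xs} v))) ⟩ ∎))
      (trans (layout-from m (length (f x) + n) _
                (trans (cong₂ appendT (length-range (f x)) eq) (append-unary (length (f x)) n)) xs)
        (cong ⟨_⟩ (mapWith∈-cong xs _ _ (λ {y} i → cong (λ us → cons ⟨ us ⟩ (w y))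
          (mapWith∈-cong (f y) _ _ (λ v → cong unary (trans
            (lemma m n (length (f x)) (idx (∈-block f i v)))
            (cong (m + n +_) (sym (idx-++⁺ʳ (f x) (∈-block f i v)))))))))))
      where
      open ≡-Reasoning
      lemma : ∀ m n l i → m + (l + n) + i ≡ m + n + (l + i)
      lemma = solve-∀

    layout-⟨⟩ : ∀ m xs →
      layoutT (unary m) ⟨ map (λ x → cons (range (f x)) (w x)) xs ⟩ ≡
      ⟨ mapWith∈ xs (λ {x} i → cons ⟨ mapWith∈ (f x) (λ v → unary (m + idx (∈-block f i v))) ⟩ (w x)) ⟩
    layout-⟨⟩ m xs = trans (layout-from m 0 nil refl xs)
      (cong (λ m → ⟨ mapWith∈ xs (λ {x} i → cons ⟨ mapWith∈ (f x) (λ v → unary (m + idx (∈-block f i v))) ⟩ (w x)) ⟩)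
            (+-identityʳ m))

-- Renaming in codes, and its effect on satisfaction and values

module _ {c ℓ₁ ℓ₂} {𝔽 : SizedField c ℓ₁ ℓ₂} where

  renVarsT renConstraintT renEquationT renPolynomialT : Tree 𝔽 → Tree 𝔽 → Tree 𝔽
  renVarsT = mapT nthT
  renConstraintT V u = cons (renVarsT V (hdT u)) (tlT u)
  renEquationT V u = cons (nthT V (hdT u)) (nthT V (tlT u))
  renPolynomialT = mapT renTerm
    where
    renTerm : Tree 𝔽 → Tree 𝔽 → Tree 𝔽
    renTerm V u = cons (hdT u) (renVarsT V (tlT u))

  renVars-polyTime : PolyTime₂ renVarsT
  renVars-polyTime = map-polyTime nth-polyTime

  renConstraint-polyTime : PolyTime₂ renConstraintT
  renConstraint-polyTime = curried (paired (apply₂ renVars-polyTime (hdᶜ input) (hdᶜ (tlᶜ input))) (tlᶜ (tlᶜ input)))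

  renEquation-polyTime : PolyTime₂ renEquationT
  renEquation-polyTime = curried (paired (apply₂ nth-polyTime (hdᶜ input) (hdᶜ (tlᶜ input)))
                                         (apply₂ nth-polyTime (hdᶜ input) (tlᶜ (tlᶜ input))))

  renPolynomial-polyTime : PolyTime₂ renPolynomialT
  renPolynomial-polyTime = map-polyTime (curried
    (paired (hdᶜ (tlᶜ input)) (apply₂ renVars-polyTime (hdᶜ input) (tlᶜ (tlᶜ input)))))

  sortsCode : ∀ {n} → List (Fin n) → Tree 𝔽
  sortsCode X = ⟨ map (unary ∘ toℕ) X ⟩

module Semantics {c ℓ₁ ℓ₂} {𝔽 : SizedField c ℓ₁ ℓ₂} (𝒟 : Domains 𝔽) where

  open SizedField 𝔽 using (Carrier) renaming (_+_ to _+ᶠ_; _*_ to _*ᶠ_)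
  open Domains 𝒟 using (Sort; Tuple; elem)

  Poly : List Sort → Set c
  Poly = Polynomial {𝒟 = 𝒟}

  value : ∀ {X} → Tuple X → Poly X → Carrier
  value φ = eval {𝒟 = 𝒟} (point {𝒟 = 𝒟} φ)

  valueMonomial : ∀ {X} → Tuple X → Monomial {𝒟 = 𝒟} X → Carrier
  valueMonomial φ = evalMonomial {𝒟 = 𝒟} (point {𝒟 = 𝒟} φ)

  Agrees : ∀ {X Y} → Ren X Y → Tuple X → Tuple Y → Set
  Agrees {X} ρ ψ φ = ∀ {t} (x : t ∈ X) → All.lookup ψ x ≡ All.lookup φ (ρ x)

  atVars-ren : ∀ {X Y} {ρ : Ren X Y} ψ φ → Agrees ρ ψ φ → ∀ {ts} (V : All (_∈ X) ts) →
               atVars {𝒟 = 𝒟} ψ V ≡ atVars {𝒟 = 𝒟} φ (All.map ρ V)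
  atVars-ren ψ φ agrees V = trans (All.map-cong V agrees) (sym (All.map-∘ V))

  atVars-++⁺ : ∀ {X} (φ : Tuple X) {ts us} (V : All (_∈ X) ts) (W : All (_∈ X) us) →
               atVars {𝒟 = 𝒟} φ (All.++⁺ V W) ≡ All.++⁺ (atVars {𝒟 = 𝒟} φ V) (atVars {𝒟 = 𝒟} φ W)
  atVars-++⁺ φ []      W = refl
  atVars-++⁺ φ (x ∷ V) W = cong (_ ∷_) (atVars-++⁺ φ V W)

  lookup-atVars : ∀ {X} (φ : Tuple X) {ts} (V : All (_∈ X) ts) → Agrees (All.lookup V) (atVars {𝒟 = 𝒟} φ V) φ
  lookup-atVars φ V x = All.lookup-map V x

  monomialCode : ∀ {X} → Monomial {𝒟 = 𝒟} X → Tree 𝔽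
  monomialCode m = ⟨ map (λ (_ , x) → var x) m ⟩

  polynomialCode : ∀ {X} → Poly X → Tree 𝔽
  polynomialCode f = ⟨ map (λ (a , m) → cons (atom a) (monomialCode m)) f ⟩

  renMonomial : ∀ {X Y} → Ren X Y → Monomial {𝒟 = 𝒟} X → Monomial {𝒟 = 𝒟} Y
  renMonomial ρ = map (λ (t , x) → t , ρ x)

  renPolynomial : ∀ {X Y} → Ren X Y → Poly X → Poly Y
  renPolynomial ρ = map (λ (a , m) → a , renMonomial ρ m)

  renMonomial-code : ∀ {V X Y} {ρ : Ren X Y} → Represents V ρ → ∀ m →
                     renVarsT V (monomialCode m) ≡ monomialCode (renMonomial ρ m)
  renMonomial-code {V} V≈ρ []            = refl
  renMonomial-code {V} V≈ρ ((t , x) ∷ m) = cong₂ cons (V≈ρ x) (renMonomial-code V≈ρ m)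

  renPolynomial-code : ∀ {V X Y} {ρ : Ren X Y} → Represents V ρ → ∀ f →
                       renPolynomialT V (polynomialCode f) ≡ polynomialCode (renPolynomial ρ f)
  renPolynomial-code V≈ρ []            = refl
  renPolynomial-code V≈ρ ((a , m) ∷ f) =
    cong₂ (λ u v → cons (cons (atom a) u) v) (renMonomial-code V≈ρ m) (renPolynomial-code V≈ρ f)

  renPolynomial-degree : ∀ {X Y} (ρ : Ren X Y) {d f} → DegreeAtMost {𝒟 = 𝒟} d f →
                         DegreeAtMost {𝒟 = 𝒟} d (renPolynomial ρ f)
  renPolynomial-degree ρ []                       = []
  renPolynomial-degree ρ {f = (_ , m) ∷ _} (m≤ ∷ f≤) =
    ≤-trans (≤-reflexive (List.length-map _ m)) m≤ ∷ renPolynomial-degree ρ f≤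

  -- An identity on the nose rather than up to `≈`: renaming leaves the terms and their order alone,
  -- so both sides are the same computation.
  value-ren : ∀ {X Y} {ρ : Ren X Y} ψ φ → Agrees ρ ψ φ → ∀ f → value ψ f ≡ value φ (renPolynomial ρ f)
  value-ren {ρ = ρ} ψ φ agrees []            = refl
  value-ren {ρ = ρ} ψ φ agrees ((a , m) ∷ f) =
    cong₂ (λ u v → a *ᶠ u +ᶠ v) (monomial m) (value-ren ψ φ agrees f)
    where
    monomial : ∀ m → valueMonomial ψ m ≡ valueMonomial φ (renMonomial ρ m)
    monomial []            = refl
    monomial ((t , x) ∷ m) = cong₂ (λ i v → elem t i *ᶠ v) (agrees x) (monomial m)

  Equation : List Sort → Set
  Equation X = Σ Sort λ t → t ∈ X × t ∈ X

  infix 4 _⊨ᵉ_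

  _⊨ᵉ_ : ∀ {X} → Tuple X → Equation X → Set
  φ ⊨ᵉ (_ , x , y) = All.lookup φ x ≡ All.lookup φ y

  equationCode : ∀ {X} → Equation X → Tree 𝔽
  equationCode (_ , x , y) = cons (var x) (var y)

  renEquation : ∀ {X Y} → Ren X Y → Equation X → Equation Y
  renEquation ρ (t , x , y) = t , ρ x , ρ y

  ⊨ᵉ-ren : ∀ {X Y} {ρ : Ren X Y} ψ φ → Agrees ρ ψ φ → ∀ E → (ψ ⊨ᵉ E) ≡ (φ ⊨ᵉ renEquation ρ E)
  ⊨ᵉ-ren ψ φ agrees (t , x , y) = cong₂ _≡_ (agrees x) (agrees y)

  renEquation-code : ∀ {V X Y} {ρ : Ren X Y} → Represents V ρ → ∀ E →
                     renEquationT V (equationCode E) ≡ equationCode (renEquation ρ E)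
  renEquation-code V≈ρ (t , x , y) = cong₂ cons (V≈ρ x) (V≈ρ y)

  -- The encoders of the statement depend on the domains; `unary` and `⟨_⟩` do not, so that codes
  -- over ℰ and over 𝒟 can be compared.
  encodeℕ≡unary : ∀ n → encodeℕ {𝒟 = 𝒟} n ≡ unary n
  encodeℕ≡unary zero    = refl
  encodeℕ≡unary (suc n) = cong (cons nil) (encodeℕ≡unary n)

  encodeList≡⟨⟩ : ∀ {a} {A : Set a} {f g : A → Tree 𝔽} → (∀ x → f x ≡ g x) →
                  ∀ xs → encodeList {𝒟 = 𝒟} f xs ≡ ⟨ map g xs ⟩
  encodeList≡⟨⟩ f≡g []       = refl
  encodeList≡⟨⟩ f≡g (x ∷ xs) = cong₂ cons (f≡g x) (encodeList≡⟨⟩ f≡g xs)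

  encodeAll≡⟨⟩ : ∀ {a p} {A : Set a} {P : A → Set p} {f g : ∀ {x} → P x → Tree 𝔽} → (∀ {x} (p : P x) → f p ≡ g p) →
                 ∀ {xs} (ps : All P xs) → encodeAll {𝒟 = 𝒟} f ps ≡ ⟨ All.reduce g ps ⟩
  encodeAll≡⟨⟩ f≡g []       = refl
  encodeAll≡⟨⟩ f≡g (p ∷ ps) = cong₂ cons (f≡g p) (encodeAll≡⟨⟩ f≡g ps)

  encodeSorts≡code : ∀ X → encodeSorts {𝒟 = 𝒟} X ≡ sortsCode X
  encodeSorts≡code = encodeList≡⟨⟩ (λ t → encodeℕ≡unary (toℕ t))

  encodePolynomial≡code : ∀ {X} (f : Poly X) → encodePolynomial {𝒟 = 𝒟} f ≡ polynomialCode f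
  encodePolynomial≡code = encodeList≡⟨⟩ λ (a , m) →
    cong (cons (atom a)) (encodeList≡⟨⟩ (λ (_ , x) → encodeℕ≡unary (idx x)) m)

  module _ {I : Set} {Γ : Language 𝒟 I} where

    constraintCode : ∀ {X} → Constraint Γ X → Tree 𝔽
    constraintCode C = cons (varsCode (Constraint.scope C)) (encodeRelation (Γ (Constraint.rel C)))

    renConstraint : ∀ {X Y} → Ren X Y → Constraint Γ X → Constraint Γ Y
    renConstraint ρ C = record { rel = Constraint.rel C ; scope = All.map ρ (Constraint.scope C) }

    renConstraint-code : ∀ {V X Y} {ρ : Ren X Y} → Represents V ρ → ∀ C →
                         renConstraintT V (constraintCode C) ≡ constraintCode (renConstraint ρ C)
    renConstraint-code V≈ρ C = cong (λ u → cons u _) (renVars V≈ρ (Constraint.scope C))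

    ⊨-ren : ∀ {X Y} {ρ : Ren X Y} ψ φ → Agrees ρ ψ φ → ∀ C → (ψ ⊨ C) ≡ (φ ⊨ renConstraint ρ C)
    ⊨-ren ψ φ agrees C = cong (T ∘ holds (Γ (Constraint.rel C))) (atVars-ren ψ φ agrees (Constraint.scope C))

    constraintsCode : ∀ {X} → List (Constraint Γ X) → Tree 𝔽
    constraintsCode Cs = ⟨ map constraintCode Cs ⟩

    encodeConstraint≡code : ∀ {X} (C : Constraint Γ X) → encodeConstraint C ≡ constraintCode C
    encodeConstraint≡code C = cong (λ u → cons u _) (encodeAll≡⟨⟩ (λ x → encodeℕ≡unary (idx x)) (Constraint.scope C))

    encodeIMP≡code : ∀ {d} (P : IMPInstance d Γ) → let open IMPInstance P in
      Problem.encode (IMP d Γ) P ≡ cons (sortsCode vars) (cons (constraintsCode constraints) (polynomialCode f))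
    encodeIMP≡code P = cong₂ cons (encodeSorts≡code vars)
      (cong₂ cons (encodeList≡⟨⟩ encodeConstraint≡code constraints) (encodePolynomial≡code f))
      where open IMPInstance P

-- Reductions and the elimination of equations

module _ {c ℓ₁ ℓ₂} {𝔽 : SizedField c ℓ₁ ℓ₂} where

  -- Separates cost from correctness: the running time is analysed on arbitrary trees, the result
  -- only on encodings.
  ≤ₚ-intro : ∀ {A B : Problem 𝔽} {F} → PolyTime F →
             (∀ a → Σ (Problem.Instance B) λ b → F (Problem.encode A a) ≡ Problem.encode B b ×
                                                 (Problem.Yes A a ⇔ Problem.Yes B b)) →
             A ≤ₚ B
  ≤ₚ-intro {A} (computable p k r) reduce = p , k , λ a →
    let b , eq , yes⇔ = reduce a
    in b , subst (λ v → p ⊢ Problem.encode A a ⇓ v within _) eq (r (Problem.encode A a)) , yes⇔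

  -- A reduction is known to run well only on encodings of instances. This is why `Computable` is
  -- relative to a presentation of the arguments: the second program is run only on outputs of the
  -- first.
  ≤ₚ-trans : ∀ {A B C : Problem 𝔽} → A ≤ₚ B → B ≤ₚ C → A ≤ₚ C
  ≤ₚ-trans {A} {B} {C} (p , j , reduce) (q , k , reduce′) = Computable.program A▹C , Computable.degree A▹C , λ a →
    let b , _ , A⇔B = reduce a
        d , _ , B⇔C = reduce′ b
    in d , Computable.run A▹C a ,
       mk⇔ (Equivalence.to B⇔C ∘ Equivalence.to A⇔B) (Equivalence.from A⇔B ∘ Equivalence.from B⇔C)
    where
    module A = Problem A
    module B = Problem B
    module C = Problem C
    A▹C : Computable A.encode (λ a → C.encode (proj₁ (reduce′ (proj₁ (reduce a)))))
    A▹C = _▹_ {F = λ a → B.encode (proj₁ (reduce a))}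
      (computable p j (λ a → proj₁ (proj₂ (reduce a))))
      (computable q k (λ a → proj₁ (proj₂ (reduce′ (proj₁ (reduce a))))))

  entries : Tree 𝔽 → ℕ
  entries (cons _ xs) = suc (entries xs)
  entries _           = 0

  -- The last leaf counts as an entry.
  maxEntry : Tree 𝔽 → ℕ
  maxEntry (cons x xs) = size x ⊔ maxEntry xs
  maxEntry u           = size u

  entries≤size : ∀ u → entries u ≤ size u
  entries≤size nil         = z≤n
  entries≤size (atom _)    = z≤n
  entries≤size (cons x xs) = s≤s (≤-trans (entries≤size xs) (m≤n+m (size xs) (size x)))

  maxEntry≤size : ∀ u → maxEntry u ≤ size u
  maxEntry≤size nil         = ≤-refl
  maxEntry≤size (atom _)    = ≤-refl
  maxEntry≤size (cons x xs) = ⊔-lub (size-hd (cons x xs)) (≤-trans (maxEntry≤size xs) (size-tl (cons x xs)))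

  size≤entries*maxEntry : ∀ m u → maxEntry u ≤ m → size u ≤ entries u * suc m + m
  size≤entries*maxEntry m nil         u≤ = u≤
  size≤entries*maxEntry m (atom _)    u≤ = u≤
  size≤entries*maxEntry m (cons x xs) u≤ = begin
    suc (size x + size xs)                ≤⟨ s≤s (+-mono-≤ (≤-trans (m≤m⊔n _ _) u≤)
                                               (size≤entries*maxEntry m xs (≤-trans (m≤n⊔m (size x) _) u≤))) ⟩
    suc (m + (entries xs * suc m + m))    ≡⟨ lemma m (entries xs) ⟩
    suc (entries xs) * suc m + m          ∎
    where
    open ≤-Reasoning
    lemma : ∀ m n → suc (m + (n * suc m + m)) ≡ suc n * suc m + m
    lemma = solve-∀

  entries-map : ∀ g w u → entries (mapT g w u) ≡ entries u
  entries-map g w nil         = refl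
  entries-map g w (atom _)    = refl
  entries-map g w (cons x xs) = cong suc (entries-map g w xs)

  maxEntry-hd : ∀ {m} → 1 ≤ m → ∀ u → maxEntry u ≤ m → size (hdT u) ≤ m
  maxEntry-hd 1≤m nil         u≤ = u≤
  maxEntry-hd 1≤m (atom _)    u≤ = 1≤m
  maxEntry-hd 1≤m (cons x xs) u≤ = ≤-trans (m≤m⊔n _ _) u≤

  maxEntry-tl : ∀ {m} → 1 ≤ m → ∀ u → maxEntry u ≤ m → maxEntry (tlT u) ≤ m
  maxEntry-tl 1≤m nil         u≤ = u≤
  maxEntry-tl 1≤m (atom _)    u≤ = 1≤m
  maxEntry-tl 1≤m (cons x xs) u≤ = ≤-trans (m≤n⊔m (size x) _) u≤

  maxEntry-nth : ∀ {m} → 1 ≤ m → ∀ u i → maxEntry u ≤ m → size (nthT u i) ≤ m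
  maxEntry-nth 1≤m u nil        u≤ = maxEntry-hd 1≤m u u≤
  maxEntry-nth 1≤m u (atom _)   u≤ = maxEntry-hd 1≤m u u≤
  maxEntry-nth 1≤m u (cons _ i) u≤ = maxEntry-nth 1≤m (tlT u) i (maxEntry-tl 1≤m u u≤)

  replaceT : Tree 𝔽 → Tree 𝔽 → Tree 𝔽
  replaceT w u = ifT (eqT u (tlT w)) (hdT w) u

  replace-polyTime : PolyTime₂ replaceT
  replace-polyTime = curried (ifᶜ (apply₂ eq-polyTime (tlᶜ input) (tlᶜ (hdᶜ input))) (hdᶜ (hdᶜ input)) (tlᶜ input))

  maxEntry-replace : ∀ {m} w → 1 ≤ m → size (hdT w) ≤ m → ∀ u → maxEntry u ≤ m → maxEntry (mapT replaceT w u) ≤ m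
  maxEntry-replace w 1≤m w≤ nil         u≤ = 1≤m
  maxEntry-replace w 1≤m w≤ (atom _)    u≤ = 1≤m
  maxEntry-replace w 1≤m w≤ (cons x xs) u≤ = ⊔-lub head≤ (maxEntry-replace w 1≤m w≤ xs (≤-trans (m≤n⊔m (size x) _) u≤))
    where
    head≤ : size (replaceT w x) ≤ _
    head≤ with truth (eqT x (tlT w))
    ... | true  = w≤
    ... | false = ≤-trans (m≤m⊔n _ _) u≤

  -- `hdT u` is an equation and `tlT u` the current table of representatives. All variables
  -- represented like the right side are redirected to the representative of the left side.
  mergeT : Tree 𝔽 → Tree 𝔽
  mergeT u = mapT replaceT (renEquationT (tlT u) (hdT u)) (tlT u)

  -- A merge can enlarge the table, since a short entry may be overwritten by a long one. But each
  -- new entry is copied from the table, or is the `nil` of a failed lookup (hence 1 ≤ m), so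
  -- neither the number of entries nor the largest entry ever grows.
  merge-bounded : ∀ m n Es u → 1 ≤ m → maxEntry u ≤ m → entries u ≤ n → FoldBounded mergeT (n * suc m + m) Es u
  merge-bounded m n Es u 1≤m max≤ len≤ = go Es
    where
    u≤ : size u ≤ n * suc m + m
    u≤ = ≤-trans (size≤entries*maxEntry m u max≤) (+-monoˡ-≤ m (*-monoˡ-≤ (suc m) len≤))
    go : ∀ Es → FoldBounded mergeT (n * suc m + m) Es u
    go nil         = u≤
    go (atom _)    = u≤
    go (cons E Es) = u≤ , merge-bounded m n Es (mergeT (cons E u)) 1≤m
      (maxEntry-replace (renEquationT u E) 1≤m (maxEntry-nth 1≤m u (hdT E) max≤) u max≤)
      (≤-trans (≤-reflexive (entries-map replaceT (renEquationT u E) u)) len≤)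

  mergeAll-polyTime : PolyTime₂ (foldT mergeT)
  mergeAll-polyTime = curried (foldᶜ merge-polyTime (hdᶜ input) (tlᶜ input)
    (+-bounded (*-bounded id-bounded (+-bounded (const-bounded 1) id-bounded)) id-bounded)
    λ u → merge-bounded (size u) (size u) (hdT u) (tlT u) (size-positive u)
      (≤-trans (maxEntry≤size (tlT u)) (size-tl u)) (≤-trans (entries≤size (tlT u)) (size-tl u)))
    where
    merge-polyTime : PolyTime mergeT
    merge-polyTime = apply₂ (map-polyTime replace-polyTime)
      (apply₂ renEquation-polyTime (tlᶜ input) (hdᶜ input)) (tlᶜ input)

  rangeT : Tree 𝔽 → Tree 𝔽
  rangeT = scanT (λ _ pre _ → lengthT pre) nil nil

  range-polyTime : PolyTime rangeT
  range-polyTime = scanᶜ (curried (apply length-polyTime (hdᶜ (tlᶜ input)))) (constant nil) input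

  rangeT-⟨⟩ : ∀ {a} {A : Set a} (f : A → Tree 𝔽) xs → rangeT ⟨ map f xs ⟩ ≡ range xs
  rangeT-⟨⟩ f xs = from 0 nil refl xs
    where
    from : ∀ n pre → lengthT pre ≡ unary n → ∀ xs →
           scanT (λ _ pre _ → lengthT pre) nil pre ⟨ map f xs ⟩ ≡ ⟨ mapWith∈ xs (λ x → unary (n + idx x)) ⟩
    from n pre eq []       = refl
    from n pre eq (x ∷ xs) = cong₂ cons (trans eq (cong unary (sym (+-identityʳ n))))
      (trans (from (suc n) _ (cong (cons nil) eq) xs)
             (cong ⟨_⟩ (mapWith∈-cong xs _ _ (λ i → cong unary (sym (+-suc n (idx i)))))))

  repsT : Tree 𝔽 → Tree 𝔽 → Tree 𝔽
  repsT Es Z = foldT mergeT Es (rangeT Z)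

  eliminateT : Tree 𝔽 → Tree 𝔽
  eliminateT u = cons Z (cons (mapT renConstraintT R Cs) (renPolynomialT R f))
    where
    Z Cs Es f R : Tree 𝔽
    Z  = hdT u
    Cs = hdT (tlT u)
    Es = hdT (tlT (tlT u))
    f  = tlT (tlT (tlT u))
    R  = repsT Es Z

  eliminate-polyTime : PolyTime eliminateT
  eliminate-polyTime = paired Z (paired (mapᶜ renConstraint-polyTime R Cs) (apply₂ renPolynomial-polyTime R f))
    where
    Z : PolyTime hdT
    Z = hdᶜ input
    Cs : PolyTime (λ u → hdT (tlT u))
    Cs = hdᶜ (tlᶜ input)
    f : PolyTime (λ u → tlT (tlT (tlT u)))
    f = tlᶜ (tlᶜ (tlᶜ input))
    R : PolyTime (λ u → repsT (hdT (tlT (tlT u))) (hdT u))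
    R = apply₂ mergeAll-polyTime (hdᶜ (tlᶜ (tlᶜ input))) (apply range-polyTime Z)

module Elimination {c ℓ₁ ℓ₂} {𝔽 : SizedField c ℓ₁ ℓ₂} {𝒟 : Domains 𝔽} {I : Set} (Γ : Language 𝒟 I) where

  open SizedField 𝔽 using (_≈_; 0#)
  open Domains 𝒟 using (Sort; Tuple)
  open Semantics 𝒟

  record System (d : ℕ) : Set c where
    field
      variables   : List Sort
      constraints : List (Constraint Γ variables)
      equations   : List (Equation variables)
      f           : Poly variables
      degree      : DegreeAtMost {𝒟 = 𝒟} d f

  SystemProblem : ℕ → Problem 𝔽
  SystemProblem d = record
    { Instance = System d
    ; encode   = λ S → let open System S in
        cons (sortsCode variables) (cons (constraintsCode constraints)
          (cons ⟨ map equationCode equations ⟩ (polynomialCode f)))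
    ; Yes      = λ S → let open System S in
        ∀ φ → All (φ ⊨_) constraints → All (φ ⊨ᵉ_) equations → value φ f ≈ 0#
    }

  module _ {Z : List Sort} where

    -- The comparison is by position, as in the program; equal positions have equal sorts, along
    -- which a is transported.
    replace : ∀ {t} (a b : t ∈ Z) → Ren Z Z
    replace a b r with idx r ≟ idx b
    ... | yes eq = subst (_∈ Z) (sym (proj₁ (idx-injective r b eq))) a
    ... | no  _  = r

    replace-code : ∀ {t} (a b : t ∈ Z) {t′} (r : t′ ∈ Z) →
                   replaceT {𝔽 = 𝔽} (cons (var a) (var b)) (var r) ≡ var (replace a b r)
    replace-code a b r with idx r ≟ idx b
    replace-code a b r | yes eq with idx-injective r b eq
    ... | refl , refl = ifT-true (truth-eq⁺ (idx r))
    replace-code a b r | no idx≢ = ifT-false (¬true⇒false λ eq → idx≢ (truth-eq⁻ (idx r) (idx b) eq))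
      where
      ¬true⇒false : ∀ {b} → ¬ b ≡ true → b ≡ false
      ¬true⇒false {true}  ¬true = ⊥-elim (¬true refl)
      ¬true⇒false {false} _     = refl

    replace-sound : ∀ (φ : Tuple Z) {t} (a b : t ∈ Z) → All.lookup φ a ≡ All.lookup φ b →
                    ∀ {t′} (r : t′ ∈ Z) → All.lookup φ r ≡ All.lookup φ (replace a b r)
    replace-sound φ a b a≡b r with idx r ≟ idx b
    ... | no  _  = refl
    ... | yes eq with idx-injective r b eq
    ... | refl , refl = sym a≡b

    replace-merges : ∀ {t} (a b : t ∈ Z) → replace a b a ≡ replace a b b
    replace-merges a b = trans first (sym second)
      where
      first : replace a b a ≡ a
      first with idx a ≟ idx b
      ... | no _ = refl
      ... | yes eq with idx-injective a b eq
      ... | refl , refl = refl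
      second : replace a b b ≡ a
      second with idx b ≟ idx b
      ... | no ≢ = ⊥-elim (≢ refl)
      ... | yes eq with idx-injective b b eq
      ... | refl , refl = refl

    merge : Equation Z → Ren Z Z → Ren Z Z
    merge (_ , x , y) ρ z = replace (ρ x) (ρ y) (ρ z)

    mergeAll : List (Equation Z) → Ren Z Z → Ren Z Z
    mergeAll []       ρ = ρ
    mergeAll (E ∷ Es) ρ = mergeAll Es (merge E ρ)

    merge-code : ∀ E (ρ : Ren Z Z) → mergeT (cons (equationCode E) (table ρ)) ≡ table (merge E ρ)
    merge-code (t , x , y) ρ = begin
      mapT replaceT (cons (nthT (table ρ) (var x)) (nthT (table ρ) (var y))) (table ρ)
        ≡⟨ cong₂ (λ a b → mapT replaceT (cons a b) (table ρ)) (nth-mapWith∈ (var ∘ ρ) x) (nth-mapWith∈ (var ∘ ρ) y) ⟩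
      mapT replaceT (cons (var (ρ x)) (var (ρ y))) (table ρ)
        ≡⟨ map-⟨⟩ replaceT _ _ ⟩
      ⟨ map (replaceT (cons (var (ρ x)) (var (ρ y)))) (mapWith∈ Z (var ∘ ρ)) ⟩
        ≡⟨ cong ⟨_⟩ (map-mapWith∈ Z (var ∘ ρ) (replaceT (cons (var (ρ x)) (var (ρ y))))) ⟩
      ⟨ mapWith∈ Z (λ z → replaceT (cons (var (ρ x)) (var (ρ y))) (var (ρ z))) ⟩
        ≡⟨ cong ⟨_⟩ (mapWith∈-cong Z _ _ (λ z → replace-code (ρ x) (ρ y) (ρ z))) ⟩
      table (merge (t , x , y) ρ) ∎
      where open ≡-Reasoning

    mergeAll-code : ∀ Es (ρ : Ren Z Z) → foldT mergeT ⟨ map equationCode Es ⟩ (table ρ) ≡ table (mergeAll Es ρ)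
    mergeAll-code []       ρ = refl
    mergeAll-code (E ∷ Es) ρ = trans (cong (foldT mergeT ⟨ map equationCode Es ⟩) (merge-code E ρ))
                                     (mergeAll-code Es (merge E ρ))

    mergeAll-sound : ∀ (φ : Tuple Z) Es (ρ : Ren Z Z) → All (φ ⊨ᵉ_) Es → Agrees ρ φ φ → Agrees (mergeAll Es ρ) φ φ
    mergeAll-sound φ []                 ρ []           agrees = agrees
    mergeAll-sound φ ((t , x , y) ∷ Es) ρ (x≡y ∷ sat) agrees = mergeAll-sound φ Es (merge (t , x , y) ρ) sat λ z →
      trans (agrees z) (replace-sound φ (ρ x) (ρ y) (trans (sym (agrees x)) (trans x≡y (agrees y))) (ρ z))

    -- Later merges act on a variable only through its current representative, so variables once
    -- identified remain so. Hence each equation, enforced when it is processed, holds in the final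
    -- table.
    mergeAll-preserves : ∀ Es (ρ : Ren Z Z) {t} (x y : t ∈ Z) → ρ x ≡ ρ y → mergeAll Es ρ x ≡ mergeAll Es ρ y
    mergeAll-preserves []                 ρ x y eq = eq
    mergeAll-preserves ((_ , a , b) ∷ Es) ρ x y eq =
      mergeAll-preserves Es (merge (_ , a , b) ρ) x y (cong (replace (ρ a) (ρ b)) eq)

    Identifies : Ren Z Z → Equation Z → Set
    Identifies ρ (_ , x , y) = ρ x ≡ ρ y

    mergeAll-merges : ∀ Es (ρ : Ren Z Z) → All (Identifies (mergeAll Es ρ)) Es
    mergeAll-merges []                 ρ = []
    mergeAll-merges ((t , x , y) ∷ Es) ρ =
      mergeAll-preserves Es (merge (t , x , y) ρ) x y (replace-merges (ρ x) (ρ y)) ∷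
      mergeAll-merges Es (merge (t , x , y) ρ)

  eliminate : ∀ d → SystemProblem d ≤ₚ IMP d Γ
  eliminate d = ≤ₚ-intro eliminate-polyTime λ S → let open System S in
    target S , trans (code S) (sym (encodeIMP≡code (target S))) , mk⇔ (to S) (from S)
    where
    rep : ∀ S → Ren (System.variables S) (System.variables S)
    rep S = mergeAll (System.equations S) (λ x → x)

    -- Variables that are not representatives stay, without constraints. So a solution of the system
    -- is itself a solution of the target, while a solution of the target is pulled back along `rep`
    -- to satisfy the equations.
    target : System d → IMPInstance d Γ
    target S = record
      { vars        = variables
      ; constraints = map (renConstraint (rep S)) constraints
      ; f           = renPolynomial (rep S) f
      ; degree      = renPolynomial-degree (rep S) degree
      }
      where open System S

    code : ∀ S → let open IMPInstance (target S) in
           eliminateT (Problem.encode (SystemProblem d) S) ≡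
           cons (sortsCode vars) (cons (constraintsCode constraints) (polynomialCode f))
    code S = cong (cons (sortsCode variables)) (trans
      (cong (λ R → cons (mapT renConstraintT R (constraintsCode constraints)) (renPolynomialT R (polynomialCode f))) reps)
      (cong₂ cons (trans (map-⟨⟩ renConstraintT _ _) (cong ⟨_⟩ (begin
          map (renConstraintT (table (rep S))) (map constraintCode constraints)
            ≡⟨ List.map-∘ constraints ⟨
          map (renConstraintT (table (rep S)) ∘ constraintCode) constraints
            ≡⟨ List.map-cong (renConstraint-code represents) constraints ⟩
          map (constraintCode ∘ renConstraint (rep S)) constraints
            ≡⟨ List.map-∘ constraints ⟩
          map constraintCode (map (renConstraint (rep S)) constraints) ∎)))
        (renPolynomial-code represents f)))
      where
      open System S
      open ≡-Reasoning
      represents : Represents (table (rep S)) (rep S)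
      represents = nth-mapWith∈ (var ∘ rep S)
      reps : repsT ⟨ map equationCode equations ⟩ (sortsCode variables) ≡ table (rep S)
      reps = trans (cong (foldT mergeT ⟨ map equationCode equations ⟩) (rangeT-⟨⟩ (unary ∘ toℕ) variables)) (mergeAll-code equations (λ x → x))

    to : ∀ S → Problem.Yes (SystemProblem d) S → Problem.Yes (IMP d Γ) (target S)
    to S yesS φ sat = subst (_≈ 0#) (value-ren ψ φ agrees f)
      (yesS ψ (All.map (λ {C} → subst id (sym (⊨-ren ψ φ agrees C))) (All.map⁻ sat))
              (All.map (λ {E} → equation {E})
                 (mergeAll-merges equations (λ x → x))))
      where
      open System S
      ψ : Tuple variables
      ψ = All.tabulate (λ x → All.lookup φ (rep S x))
      agrees : Agrees (rep S) ψ φ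
      agrees = lookup-tabulate _
      equation : ∀ {E} → Identifies (rep S) E → ψ ⊨ᵉ E
      equation {_ , x , y} eq = trans (agrees x) (trans (cong (All.lookup φ) eq) (sym (agrees y)))

    from : ∀ S → Problem.Yes (IMP d Γ) (target S) → Problem.Yes (SystemProblem d) S
    from S yesT φ satC satE = subst (_≈ 0#) (sym (value-ren φ φ agrees f))
      (yesT φ (All.map⁺ (All.map (λ {C} → subst id (⊨-ren φ φ agrees C)) satC)))
      where
      open System S
      agrees : Agrees (rep S) φ φ
      agrees = mergeAll-sound φ equations (λ x → x) satE (λ _ → refl)

-- Elimination of quantifiers

module _ {a} {A : Set a} where

  All-mapWith∈⁺ : ∀ {b p} {B : Set b} {P : B → Set p} {xs} (f : ∀ {x : A} → x ∈ xs → B) →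
                  (∀ {x} (i : x ∈ xs) → P (f i)) → All P (mapWith∈ xs f)
  All-mapWith∈⁺ {xs = []}     f Pf = []
  All-mapWith∈⁺ {xs = x ∷ xs} f Pf = Pf (here refl) ∷ All-mapWith∈⁺ (f ∘ there) (Pf ∘ there)

  All-mapWith∈⁻ : ∀ {b p} {B : Set b} {P : B → Set p} {xs} (f : ∀ {x : A} → x ∈ xs → B) →
                  All P (mapWith∈ xs f) → ∀ {x} (i : x ∈ xs) → P (f i)
  All-mapWith∈⁻ f (p ∷ ps) (here refl) = p
  All-mapWith∈⁻ f (p ∷ ps) (there i)   = All-mapWith∈⁻ (f ∘ there) ps i

module _ {c ℓ₁ ℓ₂} {𝔽 : SizedField c ℓ₁ ℓ₂} where

  -- Serves every output that concatenates one list per block: quantified sorts, constraints,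
  -- equations, and later the coordinates of the blocks.
  gather-⟨⟩ : ∀ {a b} {A : Set a} {B : Set b} (g : Tree 𝔽 → Tree 𝔽 → Tree 𝔽) w (code : B → Tree 𝔽)
              xs (p : ∀ {x : A} → x ∈ xs → Tree 𝔽) (h : ∀ {x} → x ∈ xs → List B) →
              (∀ {x} (i : x ∈ xs) → g w (p i) ≡ ⟨ map code (h i) ⟩) →
              concatT (mapT g w ⟨ mapWith∈ xs p ⟩) ≡ ⟨ map code (concat (mapWith∈ xs h)) ⟩
  gather-⟨⟩ g w code []       p h eq = refl
  gather-⟨⟩ g w code (x ∷ xs) p h eq = begin
    appendT (g w (p (here refl))) (concatT (mapT g w ⟨ mapWith∈ xs (p ∘ there) ⟩))
      ≡⟨ cong₂ appendT (eq (here refl)) (gather-⟨⟩ g w code xs (p ∘ there) (h ∘ there) (eq ∘ there)) ⟩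
    appendT ⟨ map code (h (here refl)) ⟩ ⟨ map code (concat (mapWith∈ xs (h ∘ there))) ⟩
      ≡⟨ append-⟨⟩ (map code (h (here refl))) _ ⟩
    ⟨ map code (h (here refl)) ++ map code (concat (mapWith∈ xs (h ∘ there))) ⟩
      ≡⟨ cong ⟨_⟩ (List.map-++ code (h (here refl)) _) ⟨
    ⟨ map code (h (here refl) ++ concat (mapWith∈ xs (h ∘ there))) ⟩ ∎
    where open ≡-Reasoning

  placedSortsT placedConstraintsT placedEquationsT : Tree 𝔽 → Tree 𝔽 → Tree 𝔽
  placedSortsT _ u       = hdT (tlT (tlT u))
  placedConstraintsT _ u = mapT renConstraintT (appendT (hdT (tlT u)) (hdT u)) (hdT (tlT (tlT (tlT u))))
  placedEquationsT _ u   = mapT renEquationT (appendT (hdT (tlT u)) (hdT u)) (tlT (tlT (tlT (tlT u))))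

  prenexT : Tree 𝔽 → Tree 𝔽
  prenexT u = cons (appendT (hdT u) (concatT (mapT placedSortsT nil placed)))
    (cons (concatT (mapT placedConstraintsT nil placed)) (cons (concatT (mapT placedEquationsT nil placed)) (tlT (tlT u))))
    where
    placed : Tree 𝔽
    placed = layoutT (lengthT (hdT u)) (hdT (tlT u))

  prenex-polyTime : PolyTime prenexT
  prenex-polyTime = paired
    (apply₂ append-polyTime (hdᶜ input) (gather (curried (hdᶜ (tlᶜ (tlᶜ (tlᶜ input)))))))
    (paired (gather (curried (mapᶜ renConstraint-polyTime args (hdᶜ (tlᶜ (tlᶜ (tlᶜ (tlᶜ input))))))))
      (paired (gather (curried (mapᶜ renEquation-polyTime args (tlᶜ (tlᶜ (tlᶜ (tlᶜ (tlᶜ input)))))))) (tlᶜ (tlᶜ input))))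
    where
    gather : ∀ {g} → PolyTime₂ g →
             PolyTime (λ u → concatT (mapT g nil (layoutT (lengthT (hdT u)) (hdT (tlT u)))))
    gather P = apply concat-polyTime (mapᶜ P (constant nil)
      (layoutᶜ (apply length-polyTime (hdᶜ input)) (hdᶜ (tlᶜ input))))
    args : PolyTime (λ u → appendT (hdT (tlT (tlT u))) (hdT (tlT u)))
    args = apply₂ append-polyTime (hdᶜ (tlᶜ (tlᶜ input))) (hdᶜ (tlᶜ input))

module Prenex {c ℓ₁ ℓ₂} {𝔽 : SizedField c ℓ₁ ℓ₂} {𝒟 : Domains 𝔽} {I : Set} (Γ : Language 𝒟 I) where

  open SizedField 𝔽 using (_≈_; 0#)
  open Domains 𝒟 using (Sort; Tuple)
  open Semantics 𝒟
  open Elimination Γ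

  -- A primitive positive formula: free variables ts, quantified variables us.
  record Template : Set where
    field
      {ts us}     : List Sort
      constraints : List (Constraint Γ (ts ++ us))
      equations   : List (Equation (ts ++ us))

    Holds : Tuple ts → Set
    Holds z = Σ (Tuple us) λ w → All (All.++⁺ z w ⊨_) constraints × All (All.++⁺ z w ⊨ᵉ_) equations

    bodyCode : Tree 𝔽
    bodyCode = cons (sortsCode us) (cons (constraintsCode constraints) ⟨ map equationCode equations ⟩)

    -- Shaped as a block for `layoutT`: the variables to be placed come first, the rest is carried
    -- along.
    templateCode : Tree 𝔽
    templateCode = cons (range us) bodyCode

  open Template using (ts; us; Holds; bodyCode; templateCode) public

  record Formula (Y : List Sort) : Set where
    constructor _at_
    field
      template : Template
      args     : All (_∈ Y) (ts template)

  open Formula using (template; args) public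

  formulaT : Tree 𝔽 → Tree 𝔽 → Tree 𝔽
  formulaT τ V = cons (hdT τ) (cons V (tlT τ))

  formulaCode : ∀ {Y} → Formula Y → Tree 𝔽
  formulaCode F = formulaT (templateCode (template F)) (varsCode (args F))

  _⊨ᶠ_ : ∀ {Y} → Tuple Y → Formula Y → Set
  φ ⊨ᶠ F = Holds (template F) (atVars {𝒟 = 𝒟} φ (args F))

  record FormulaSystem (d : ℕ) : Set c where
    field
      variables : List Sort
      formulas  : List (Formula variables)
      f         : Poly variables
      degree    : DegreeAtMost {𝒟 = 𝒟} d f

  FormulaProblem : ℕ → Problem 𝔽
  FormulaProblem d = record
    { Instance = FormulaSystem d
    ; encode   = λ S → let open FormulaSystem S in
        cons (sortsCode variables) (cons ⟨ map formulaCode formulas ⟩ (polynomialCode f))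
    ; Yes      = λ S → let open FormulaSystem S in ∀ φ → All (φ ⊨ᶠ_) formulas → value φ f ≈ 0#
    }

  module _ {Y : List Sort} (Fs : List (Formula Y)) where

    quantified : Formula Y → List Sort
    quantified F = us (template F)

    extended : List Sort
    extended = Y ++ concatMap quantified Fs

    old : Ren Y extended
    old = ∈-++⁺ˡ

    fresh : ∀ {F} → F ∈ Fs → Ren (quantified F) extended
    fresh i v = ∈-++⁺ʳ Y (∈-block quantified i v)

    scope : ∀ {F} → F ∈ Fs → All (_∈ extended) (ts (template F) ++ quantified F)
    scope {F} i = All.++⁺ (All.map old (args F)) (All.tabulate (fresh i))

    -- The assignment to a template is `φ⁺` read along `scope i`: its arguments are old variables,
    -- and the witness w sits on the fresh ones.
    scope-agrees : ∀ (φ : Tuple Y) (φ⁺ : Tuple extended) → Agrees old φ φ⁺ →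
                   ∀ {F} (i : F ∈ Fs) (w : Tuple (quantified F)) → Agrees (fresh i) w φ⁺ →
                   Agrees (All.lookup (scope i)) (All.++⁺ (atVars {𝒟 = 𝒟} φ (args F)) w) φ⁺
    scope-agrees φ φ⁺ agrees {F} i w agrees′ x = trans
      (cong (λ ψ → All.lookup ψ x) (begin
        All.++⁺ (atVars {𝒟 = 𝒟} φ (args F)) w
          ≡⟨ cong₂ All.++⁺ (atVars-ren φ φ⁺ agrees (args F)) (lookup-extensional _ _ λ v → begin
               All.lookup w v                                                     ≡⟨ agrees′ v ⟩
               All.lookup φ⁺ (fresh i v)                                          ≡⟨ cong (All.lookup φ⁺) (lookup-tabulate (fresh i) v) ⟨
               All.lookup φ⁺ (All.lookup (All.tabulate (fresh i)) v)              ≡⟨ lookup-atVars φ⁺ (All.tabulate (fresh i)) v ⟨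
               All.lookup (atVars {𝒟 = 𝒟} φ⁺ (All.tabulate (fresh i))) v          ∎) ⟩
        All.++⁺ (atVars {𝒟 = 𝒟} φ⁺ (All.map old (args F))) (atVars {𝒟 = 𝒟} φ⁺ (All.tabulate (fresh i)))
          ≡⟨ atVars-++⁺ φ⁺ (All.map old (args F)) _ ⟨
        atVars {𝒟 = 𝒟} φ⁺ (scope i) ∎))
      (lookup-atVars φ⁺ (scope i) x)
      where open ≡-Reasoning

    constraintsOf : ∀ {F} → F ∈ Fs → List (Constraint Γ extended)
    constraintsOf {F} i = map (renConstraint (All.lookup (scope i))) (Template.constraints (template F))

    equationsOf : ∀ {F} → F ∈ Fs → List (Equation extended)
    equationsOf {F} i = map (renEquation (All.lookup (scope i))) (Template.equations (template F))

    shifted : ∀ {F} → F ∈ Fs → Tree 𝔽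
    shifted {F} i = ⟨ mapWith∈ (quantified F) (λ v → unary (length Y + idx (∈-block quantified i v))) ⟩

    placed-code : layoutT (lengthT (sortsCode Y)) ⟨ map formulaCode Fs ⟩ ≡
                  ⟨ mapWith∈ Fs (λ {F} i → cons (shifted i) (cons (varsCode (args F)) (bodyCode (template F)))) ⟩
    placed-code = trans
      (cong (λ u → layoutT u ⟨ map formulaCode Fs ⟩) (trans (length-⟨⟩ _) (cong unary (List.length-map (unary {𝔽 = 𝔽} ∘ toℕ) Y))))
      (layout-⟨⟩ quantified (λ F → cons (varsCode (args F)) (bodyCode (template F))) (length Y) Fs)

    scope-code : ∀ {F} (i : F ∈ Fs) → appendT (varsCode (args F)) (shifted i) ≡ varsCode (scope i)
    scope-code {F} i = trans (append-⟨⟩ (All.reduce var (args F)) _) (cong ⟨_⟩ (begin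
      All.reduce var (args F) ++ mapWith∈ (quantified F) (λ v → unary (length Y + idx (∈-block quantified i v)))
        ≡⟨ cong₂ _++_
             (trans (reduce-cong (λ x → cong unary (sym (idx-++⁺ˡ x))) (args F)) (sym (reduce-map var old (args F))))
             (trans (mapWith∈-cong (quantified F) _ _ (λ v → cong unary (sym (idx-++⁺ʳ Y (∈-block quantified i v)))))
                    (sym (reduce-tabulate var (fresh i)))) ⟩
      All.reduce var (All.map old (args F)) ++ All.reduce var (All.tabulate (fresh i))
        ≡⟨ reduce-++⁺ var (All.map old (args F)) _ ⟨
      All.reduce var (scope i) ∎))
      where open ≡-Reasoning

    scope-represents : ∀ {F} (i : F ∈ Fs) →
                       Represents (appendT (varsCode (args F)) (shifted i)) (All.lookup (scope i))
    scope-represents i x = trans (cong (λ V → nthT V (var x)) (scope-code i)) (vars-represents (scope i) x)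

  -- The fresh variables come after the old ones, whose indices therefore do not change: the program
  -- copies the polynomial verbatim.
  renPolynomial-code-id : ∀ {X Y} (ρ : Ren X Y) → (∀ {t} (x : t ∈ X) → idx (ρ x) ≡ idx x) →
                          ∀ f → polynomialCode f ≡ polynomialCode (renPolynomial ρ f)
  renPolynomial-code-id ρ ρ≡ []            = refl
  renPolynomial-code-id {X} ρ ρ≡ ((a , m) ∷ f) =
    cong₂ (λ u v → cons (cons (atom a) u) v) (monomial m) (renPolynomial-code-id ρ ρ≡ f)
    where
    monomial : ∀ (m : Monomial {𝒟 = 𝒟} X) → monomialCode m ≡ monomialCode (renMonomial ρ m)
    monomial []            = refl
    monomial ((t , x) ∷ m) = cong₂ cons (cong unary (sym (ρ≡ x))) (monomial m)

  -- Membership speaks about all solutions, and an existential quantifier in a premise is a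
  -- universal one in front. Witnesses thus become further coordinates of the solution, disjoint for
  -- different formulas, and the polynomial does not see them.
  prenex : ∀ d → FormulaProblem d ≤ₚ SystemProblem d
  prenex d = ≤ₚ-intro prenex-polyTime λ S → target S , code S , mk⇔ (to S) (from S)
    where
    target : FormulaSystem d → System d
    target S = record
      { variables   = extended formulas
      ; constraints = concat (mapWith∈ formulas (constraintsOf formulas))
      ; equations   = concat (mapWith∈ formulas (equationsOf formulas))
      ; f           = renPolynomial (old formulas) f
      ; degree      = renPolynomial-degree (old formulas) degree
      }
      where open FormulaSystem S

    code : ∀ S → prenexT (Problem.encode (FormulaProblem d) S) ≡ Problem.encode (SystemProblem d) (target S)
    code S = trans (cong (λ u → cons (appendT (sortsCode variables) (concatT (mapT placedSortsT nil u)))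
        (cons (concatT (mapT placedConstraintsT nil u))
          (cons (concatT (mapT placedEquationsT nil u)) (polynomialCode f))))
        (placed-code formulas))
      (cong₂ cons
        (trans (cong (appendT (sortsCode variables)) (trans
            (gather-⟨⟩ placedSortsT nil (unary ∘ toℕ) formulas _ (λ {F} _ → us (template F)) (λ _ → refl))
            (cong (sortsCode ∘ concat) (mapWith∈≗map (us ∘ template) formulas))))
          (trans (append-⟨⟩ (map (unary ∘ toℕ) variables) _)
                 (cong ⟨_⟩ (sym (List.map-++ (unary ∘ toℕ) variables _)))))
        (cong₂ cons
          (gather-⟨⟩ placedConstraintsT nil constraintCode formulas _ (constraintsOf formulas) (λ {F} i →
            trans (map-⟨⟩ renConstraintT _ _) (cong ⟨_⟩
              (map-commute (renConstraint-code (scope-represents formulas i)) (Template.constraints (template F))))))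
          (cong₂ cons
            (gather-⟨⟩ placedEquationsT nil equationCode formulas _ (equationsOf formulas) (λ {F} i →
              trans (map-⟨⟩ renEquationT _ _) (cong ⟨_⟩
                (map-commute (renEquation-code (scope-represents formulas i)) (Template.equations (template F))))))
            (renPolynomial-code-id (old formulas) idx-++⁺ˡ f))))
      where
      open FormulaSystem S
      map-commute : ∀ {A B : Set} {p : A → Tree 𝔽} {q : B → Tree 𝔽} {g : Tree 𝔽 → Tree 𝔽} {h : A → B} →
                    (∀ x → g (p x) ≡ q (h x)) → ∀ xs → map g (map p xs) ≡ map q (map h xs)
      map-commute eq xs = trans (sym (List.map-∘ xs)) (trans (List.map-cong eq xs) (List.map-∘ xs))

    to : ∀ S → Problem.Yes (FormulaProblem d) S → Problem.Yes (SystemProblem d) (target S)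
    to S yesS φ⁺ satC satE = subst (_≈ 0#) (value-ren φ φ⁺ agrees f)
      (yesS φ (All.tabulate λ {F} i → w i ,
        (All.map (λ {C} → subst id (sym (⊨-ren (z i) φ⁺ (scope-agrees formulas φ φ⁺ agrees i (w i) (lookup-tabulate _)) C)))
          (All.map⁻ (All-mapWith∈⁻ (constraintsOf formulas) (All.concat⁻ satC) i)) ,
         All.map (λ {E} → subst id (sym (⊨ᵉ-ren (z i) φ⁺ (scope-agrees formulas φ φ⁺ agrees i (w i) (lookup-tabulate _)) E)))
          (All.map⁻ (All-mapWith∈⁻ (equationsOf formulas) (All.concat⁻ satE) i)))))
      where
      open FormulaSystem S
      φ : Tuple variables
      φ = All.tabulate (λ x → All.lookup φ⁺ (old formulas x))
      agrees : Agrees (old formulas) φ φ⁺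
      agrees = lookup-tabulate _
      w : ∀ {F} → F ∈ formulas → Tuple (us (template F))
      w i = All.tabulate (λ v → All.lookup φ⁺ (fresh formulas i v))
      z : ∀ {F} → F ∈ formulas → Tuple (ts (template F) ++ us (template F))
      z {F} i = All.++⁺ (atVars {𝒟 = 𝒟} φ (args F)) (w i)

    from : ∀ S → Problem.Yes (SystemProblem d) (target S) → Problem.Yes (FormulaProblem d) S
    from S yesT φ sat = subst (_≈ 0#) (sym (value-ren φ φ⁺ agrees f))
      (yesT φ⁺
        (All.concat⁺ (All-mapWith∈⁺ (constraintsOf formulas) λ i → All.map⁺
          (All.map (λ {C} → subst id (⊨-ren (z i) φ⁺ (scope-agrees formulas φ φ⁺ agrees i (w i) (agrees-w i)) C))
                   (proj₁ (proj₂ (All.lookup sat i))))))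
        (All.concat⁺ (All-mapWith∈⁺ (equationsOf formulas) λ i → All.map⁺
          (All.map (λ {E} → subst id (⊨ᵉ-ren (z i) φ⁺ (scope-agrees formulas φ φ⁺ agrees i (w i) (agrees-w i)) E))
                   (proj₂ (proj₂ (All.lookup sat i)))))))
      where
      open FormulaSystem S
      w : ∀ {F} → F ∈ formulas → Tuple (us (template F))
      w i = proj₁ (All.lookup sat i)
      z : ∀ {F} → F ∈ formulas → Tuple (ts (template F) ++ us (template F))
      z {F} i = All.++⁺ (atVars {𝒟 = 𝒟} φ (args F)) (w i)
      ws : All (Tuple ∘ us ∘ template) formulas
      ws = All.tabulate w
      φ⁺ : Tuple (extended formulas)
      φ⁺ = All.++⁺ φ (flat (quantified formulas) ws)
      agrees : Agrees (old formulas) φ φ⁺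
      agrees x = sym (lookup-++⁺ˡ φ _ x)
      agrees-w : ∀ {F} (i : F ∈ formulas) → Agrees (fresh formulas i) (w i) φ⁺
      agrees-w i v = sym (trans (lookup-++⁺ʳ φ _ _)
        (trans (lookup-flat (quantified formulas) ws i v) (cong (λ z → All.lookup z v) (lookup-tabulate w i))))

-- Multiplying out

module _ {c ℓ₁ ℓ₂} {𝔽 : SizedField c ℓ₁ ℓ₂} where

  mulTermT mulPolynomialT : Tree 𝔽 → Tree 𝔽 → Tree 𝔽
  mulTermT q p = cons (mulT (hdT q) (hdT p)) (appendT (tlT q) (tlT p))
  mulPolynomialT Q P = concatT (mapT (λ P q → mapT mulTermT q P) P Q)

  mulPolynomial-polyTime : PolyTime₂ mulPolynomialT
  mulPolynomial-polyTime = curried (apply concat-polyTime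
    (mapᶜ (curried (mapᶜ mulTerm-polyTime (tlᶜ input) (hdᶜ input))) (tlᶜ input) (hdᶜ input)))
    where
    mulTerm-polyTime : PolyTime₂ mulTermT
    mulTerm-polyTime = curried (paired
      (apply₂ mul-polyTime (hdᶜ (hdᶜ input)) (hdᶜ (tlᶜ input)))
      (apply₂ append-polyTime (tlᶜ (hdᶜ input)) (tlᶜ (tlᶜ input))))

  -- The number of multiplications is bounded by the program, not by the input,
  -- so the iterated products stay polynomial in size.
  expandTermT : ℕ → Tree 𝔽 → Tree 𝔽 → Tree 𝔽
  expandTermT zero    Q ps = Q
  expandTermT (suc d) Q ps = ifT ps (expandTermT d (mulPolynomialT Q (hdT ps)) (tlT ps)) Q

  expandTerm-polyTime : ∀ d → PolyTime₂ (expandTermT d)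
  expandTerm-polyTime zero    = curried (hdᶜ input)
  expandTerm-polyTime (suc d) = curried (ifᶜ (tlᶜ input)
    (apply₂ (expandTerm-polyTime d) (apply₂ mulPolynomial-polyTime (hdᶜ input) (hdᶜ (tlᶜ input))) (tlᶜ (tlᶜ input)))
    (hdᶜ input))

  -- `cons (cons (hdT t) nil) nil` codes the coefficient as a constant polynomial, from which the
  -- product is built up.
  expandTermsT : ℕ → Tree 𝔽 → Tree 𝔽
  expandTermsT d f = concatT (mapT (λ _ t → expandTermT d (cons (cons (hdT t) nil) nil) (tlT t)) nil f)

  expandT : ℕ → Tree 𝔽 → Tree 𝔽
  expandT d u = cons (hdT u) (cons (hdT (tlT u)) (expandTermsT d (tlT (tlT u))))

  expand-polyTime : ∀ d → PolyTime (expandT d)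
  expand-polyTime d = paired (hdᶜ input) (paired (hdᶜ (tlᶜ input)) (apply concat-polyTime
    (mapᶜ (curried (apply₂ (expandTerm-polyTime d)
                           (paired (paired (hdᶜ (tlᶜ input)) (constant nil)) (constant nil)) (tlᶜ (tlᶜ input))))
          (constant nil) (tlᶜ (tlᶜ input)))))

module FieldProperties {c ℓ₁ ℓ₂} (𝔽 : SizedField c ℓ₁ ℓ₂) where

  open SizedField 𝔽 using (heytingField)

  commutativeRing : CommutativeRing c ℓ₁
  commutativeRing = HeytingCommutativeRing.commutativeRing (HeytingField.heytingCommutativeRing heytingField)

  open CommutativeRing commutativeRing public
    renaming (_+_ to _+ᶠ_; _*_ to _*ᶠ_; refl to ≈-refl; sym to ≈-sym; trans to ≈-trans; reflexive to ≈-reflexive)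
    using (Carrier; _≈_; 0#; 1#; -_; +-cong; *-cong; +-congˡ; *-congˡ; *-congʳ;
           -‿inverseʳ; distribˡ; distribʳ; zeroˡ; zeroʳ; setoid)
    renaming (+-assoc to +ᶠ-assoc; +-identityˡ to +ᶠ-identityˡ; +-identityʳ to +ᶠ-identityʳ;
              *-assoc to *ᶠ-assoc; *-identityˡ to *ᶠ-identityˡ; *-identityʳ to *ᶠ-identityʳ)

  open CommutativeSemigroupProperties (CommutativeRing.*-commutativeSemigroup commutativeRing) public
    using (interchange)

module PolynomialArithmetic {c ℓ₁ ℓ₂} {𝔽 : SizedField c ℓ₁ ℓ₂} (𝒟 : Domains 𝔽) where

  open FieldProperties 𝔽
  open Domains 𝒟 using (Sort; Tuple; elem)
  open Semantics 𝒟
  open SetoidReasoning setoid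

  mulTerm : ∀ {X} → Carrier × Monomial {𝒟 = 𝒟} X → Carrier × Monomial {𝒟 = 𝒟} X → Carrier × Monomial {𝒟 = 𝒟} X
  mulTerm (a , m) (b , n) = a *ᶠ b , m ++ n

  mulPolynomial : ∀ {X} → Poly X → Poly X → Poly X
  mulPolynomial Q P = concatMap (λ q → map (mulTerm q) P) Q

  module _ {X : List Sort} (φ : Tuple X) where

    valueMonomial-++ : ∀ m n → valueMonomial φ (m ++ n) ≈ valueMonomial φ m *ᶠ valueMonomial φ n
    valueMonomial-++ []            n = ≈-sym (*ᶠ-identityˡ _)
    valueMonomial-++ ((t , x) ∷ m) n = ≈-trans (*-congˡ (valueMonomial-++ m n)) (≈-sym (*ᶠ-assoc _ _ _))

    value-++ : ∀ P Q → value φ (P ++ Q) ≈ value φ P +ᶠ value φ Q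
    value-++ []            Q = ≈-sym (+ᶠ-identityˡ _)
    value-++ ((a , m) ∷ P) Q = ≈-trans (+-congˡ (value-++ P Q)) (≈-sym (+ᶠ-assoc _ _ _))

    value-mulTerm : ∀ a m P → value φ (map (mulTerm (a , m)) P) ≈ a *ᶠ valueMonomial φ m *ᶠ value φ P
    value-mulTerm a m []            = ≈-sym (zeroʳ _)
    value-mulTerm a m ((b , n) ∷ P) = begin
      a *ᶠ b *ᶠ valueMonomial φ (m ++ n) +ᶠ value φ (map (mulTerm (a , m)) P)
        ≈⟨ +-cong (≈-trans (*-congˡ (valueMonomial-++ m n)) (interchange a b _ _)) (value-mulTerm a m P) ⟩
      a *ᶠ valueMonomial φ m *ᶠ (b *ᶠ valueMonomial φ n) +ᶠ a *ᶠ valueMonomial φ m *ᶠ value φ P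
        ≈⟨ distribˡ _ _ _ ⟨
      a *ᶠ valueMonomial φ m *ᶠ (b *ᶠ valueMonomial φ n +ᶠ value φ P) ∎

    value-mul : ∀ Q P → value φ (mulPolynomial Q P) ≈ value φ Q *ᶠ value φ P
    value-mul []            P = ≈-sym (zeroˡ _)
    value-mul ((a , m) ∷ Q) P = begin
      value φ (map (mulTerm (a , m)) P ++ mulPolynomial Q P)
        ≈⟨ value-++ (map (mulTerm (a , m)) P) (mulPolynomial Q P) ⟩
      value φ (map (mulTerm (a , m)) P) +ᶠ value φ (mulPolynomial Q P)
        ≈⟨ +-cong (value-mulTerm a m P) (value-mul Q P) ⟩
      a *ᶠ valueMonomial φ m *ᶠ value φ P +ᶠ value φ Q *ᶠ value φ P
        ≈⟨ distribʳ _ _ _ ⟨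
      (a *ᶠ valueMonomial φ m +ᶠ value φ Q) *ᶠ value φ P ∎

  degree-++ : ∀ {X d} {P Q : Poly X} → DegreeAtMost {𝒟 = 𝒟} d P → DegreeAtMost {𝒟 = 𝒟} d Q →
              DegreeAtMost {𝒟 = 𝒟} d (P ++ Q)
  degree-++ = All.++⁺

  degree-mul : ∀ {X d e} {Q P : Poly X} → DegreeAtMost {𝒟 = 𝒟} d Q → DegreeAtMost {𝒟 = 𝒟} e P →
               DegreeAtMost {𝒟 = 𝒟} (d + e) (mulPolynomial Q P)
  degree-mul []                           P≤ = []
  degree-mul {Q = (_ , m) ∷ Q} (m≤ ∷ Q≤) P≤ = degree-++
    (All.map⁺ (All.map (λ {(_ , n)} n≤ → ≤-trans (≤-reflexive (List.length-++ m)) (+-mono-≤ m≤ n≤)) P≤))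
    (degree-mul Q≤ P≤)

  mulPolynomial-code : ∀ {X} (Q P : Poly X) →
    mulPolynomialT (polynomialCode Q) (polynomialCode P) ≡ polynomialCode (mulPolynomial Q P)
  mulPolynomial-code []            P = refl
  mulPolynomial-code {X} ((a , m) ∷ Q) P = trans (cong₂ appendT (row P) (mulPolynomial-code Q P))
    (trans (append-⟨⟩ (map _ (map (mulTerm (a , m)) P)) _)
           (cong ⟨_⟩ (sym (List.map-++ _ (map (mulTerm (a , m)) P) (mulPolynomial Q P)))))
    where
    row : ∀ (P : Poly X) → mapT mulTermT (cons (atom a) (monomialCode m)) (polynomialCode P) ≡
                polynomialCode (map (mulTerm (a , m)) P)
    row []            = refl
    row ((b , n) ∷ P) = cong₂ (λ u v → cons (cons (atom (a *ᶠ b)) u) v)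
      (trans (append-⟨⟩ _ (map _ n)) (cong ⟨_⟩ (sym (List.map-++ _ m n)))) (row P)

module Expansion {c ℓ₁ ℓ₂} {𝔽 : SizedField c ℓ₁ ℓ₂} {𝒟 : Domains 𝔽} {I : Set} (Γ : Language 𝒟 I) where

  open FieldProperties 𝔽
  open Domains 𝒟 using (Sort; Tuple)
  open Semantics 𝒟
  open PolynomialArithmetic 𝒟
  open Prenex Γ

  -- A sum of terms a·p₁·…·pₖ with polynomials pᵢ.
  Composite : List Sort → Set c
  Composite Y = List (Carrier × List (Poly Y))

  module _ {Y : List Sort} where

    productValue : Tuple Y → List (Poly Y) → Carrier
    productValue φ []       = 1#
    productValue φ (p ∷ ps) = value φ p *ᶠ productValue φ ps

    compositeValue : Tuple Y → Composite Y → Carrier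
    compositeValue φ []             = 0#
    compositeValue φ ((a , ps) ∷ g) = a *ᶠ productValue φ ps +ᶠ compositeValue φ g

    factorsCode : List (Poly Y) → Tree 𝔽
    factorsCode ps = ⟨ map polynomialCode ps ⟩

    compositeCode : Composite Y → Tree 𝔽
    compositeCode g = ⟨ map (λ (a , ps) → cons (atom a) (factorsCode ps)) g ⟩

    expandTerm : Poly Y → List (Poly Y) → Poly Y
    expandTerm Q []       = Q
    expandTerm Q (p ∷ ps) = expandTerm (mulPolynomial Q p) ps

    expandTerms : Composite Y → Poly Y
    expandTerms = concatMap (λ (a , ps) → expandTerm ((a , []) ∷ []) ps)

    value-expandTerm : ∀ φ Q ps → value φ (expandTerm Q ps) ≈ value φ Q *ᶠ productValue φ ps
    value-expandTerm φ Q []       = ≈-sym (*ᶠ-identityʳ _)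
    value-expandTerm φ Q (p ∷ ps) = ≈-trans (value-expandTerm φ (mulPolynomial Q p) ps)
      (≈-trans (*-congʳ (value-mul φ Q p)) (*ᶠ-assoc _ _ _))

    value-expandTerms : ∀ φ g → value φ (expandTerms g) ≈ compositeValue φ g
    value-expandTerms φ []             = ≈-refl
    value-expandTerms φ ((a , ps) ∷ g) = ≈-trans (value-++ φ (expandTerm ((a , []) ∷ []) ps) (expandTerms g))
      (+-cong (≈-trans (value-expandTerm φ ((a , []) ∷ []) ps)
                       (*-congʳ (≈-trans (+ᶠ-identityʳ _) (*ᶠ-identityʳ a))))
              (value-expandTerms φ g))

    degree-expandTerm : ∀ {k d e Q ps} → length ps ≤ d → All (DegreeAtMost {𝒟 = 𝒟} k) ps →
                        DegreeAtMost {𝒟 = 𝒟} e Q → DegreeAtMost {𝒟 = 𝒟} (e + k * d) (expandTerm Q ps)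
    degree-expandTerm {k} {d} {e} _ [] Q≤ = All.map (λ m≤ → ≤-trans m≤ (m≤m+n e (k * d))) Q≤
    degree-expandTerm {k} {suc d} {e} {Q} {p ∷ ps} (s≤s len≤) (p≤ ∷ ps≤) Q≤ =
      subst (λ n → DegreeAtMost {𝒟 = 𝒟} n (expandTerm (mulPolynomial Q p) ps)) (lemma e k d) (degree-expandTerm len≤ ps≤ (degree-mul Q≤ p≤))
      where
      lemma : ∀ e k d → e + k + k * d ≡ e + k * suc d
      lemma = solve-∀

    CompositeDegree : ℕ → ℕ → Composite Y → Set c
    CompositeDegree k d = All (λ (_ , ps) → length ps ≤ d × All (DegreeAtMost {𝒟 = 𝒟} k) ps)

    degree-expandTerms : ∀ {k d g} → CompositeDegree k d g → DegreeAtMost {𝒟 = 𝒟} (k * d) (expandTerms g)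
    degree-expandTerms []                = []
    degree-expandTerms ((len≤ , ps≤) ∷ g≤) =
      degree-++ (degree-expandTerm len≤ ps≤ (z≤n ∷ [])) (degree-expandTerms g≤)

    -- The program has d multiplications built in and would ignore further factors; the bound on the
    -- length says that there are none.
    expandTerm-code : ∀ {d} Q ps → length ps ≤ d →
                      expandTermT d (polynomialCode Q) (factorsCode ps) ≡ polynomialCode (expandTerm Q ps)
    expandTerm-code {zero}  Q []       _          = refl
    expandTerm-code {suc d} Q []       _          = refl
    expandTerm-code {suc d} Q (p ∷ ps) (s≤s len≤) =
      trans (cong (λ u → expandTermT d u (factorsCode ps)) (mulPolynomial-code Q p))
            (expandTerm-code (mulPolynomial Q p) ps len≤)

    expandTerms-code : ∀ {k d g} → CompositeDegree k d g →
                       expandTermsT d (compositeCode g) ≡ polynomialCode (expandTerms g)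
    expandTerms-code []                                      = refl
    expandTerms-code {g = (a , ps) ∷ g} ((len≤ , _) ∷ g≤) =
      trans (cong₂ appendT (expandTerm-code ((a , []) ∷ []) ps len≤) (expandTerms-code g≤))
        (trans (append-⟨⟩ (map _ (expandTerm ((a , []) ∷ []) ps)) _)
               (cong ⟨_⟩ (sym (List.map-++ _ (expandTerm ((a , []) ∷ []) ps) (expandTerms g)))))

  record CompositeSystem (k d : ℕ) : Set c where
    field
      variables : List Sort
      formulas  : List (Formula variables)
      f         : Composite variables
      degree    : CompositeDegree k d f

  CompositeProblem : ℕ → ℕ → Problem 𝔽
  CompositeProblem k d = record
    { Instance = CompositeSystem k d
    ; encode   = λ S → let open CompositeSystem S in
        cons (sortsCode variables) (cons ⟨ map formulaCode formulas ⟩ (compositeCode f))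
    ; Yes      = λ S → let open CompositeSystem S in ∀ φ → All (φ ⊨ᶠ_) formulas → compositeValue φ f ≈ 0#
    }

  expand : ∀ k d → CompositeProblem k d ≤ₚ FormulaProblem (k * d)
  expand k d = ≤ₚ-intro (expand-polyTime d) λ S → let open CompositeSystem S in
    record { variables = variables ; formulas = formulas ; f = expandTerms f ; degree = degree-expandTerms degree } ,
    cong (λ u → cons (sortsCode variables) (cons ⟨ map formulaCode formulas ⟩ u)) (expandTerms-code degree) ,
    mk⇔ (λ yes φ sat → ≈-trans (value-expandTerms φ f) (yes φ sat))
        (λ yes φ sat → ≈-trans (≈-sym (value-expandTerms φ f)) (yes φ sat))

-- Interpolation

module Interpolation {c ℓ₁ ℓ₂} {𝔽 : SizedField c ℓ₁ ℓ₂} (𝒟 : Domains 𝔽) where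

  open SizedField 𝔽 using (_#?_; tight; #⇒invertible)
  open FieldProperties 𝔽
  open Domains 𝒟 using (Sort; Dom; Tuple; card; elem; injective)
  open Semantics 𝒟
  open PolynomialArithmetic 𝒟
  open SetoidReasoning setoid

  -- Injectivity of `elem` only excludes `≈`; tightness and decidability turn this into apartness,
  -- and apart elements have an invertible difference.
  inverse : ∀ {t} {a b : Dom t} → a ≢ b → ∃ λ z → z *ᶠ (elem t a +ᶠ - elem t b) ≈ 1#
  inverse {t} {a} {b} a≢b with elem t a #? elem t b
  ... | yes a#b = proj₁ (#⇒invertible a#b) , proj₁ (proj₂ (#⇒invertible a#b))
  ... | no ¬a#b = ⊥-elim (a≢b (injective t (proj₁ (tight _ _) ¬a#b)))

  constantPolynomial : ∀ {X} → Carrier → Poly X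
  constantPolynomial a = (a , []) ∷ []

  value-constant : ∀ {X} (φ : Tuple X) a → value φ (constantPolynomial a) ≈ a
  value-constant φ a = ≈-trans (+ᶠ-identityʳ _) (*ᶠ-identityʳ a)

  module _ {X : List Sort} {t : Sort} (x : t ∈ X) where

    -- (x − b) / (c − b)
    lagrangeFactor : Dom t → Dom t → Poly X
    lagrangeFactor c b with c Fin.≟ b
    -- The factor at b = c is 1, so that the product may run over the whole domain.
    ... | yes _  = constantPolynomial 1#
    ... | no c≢b = let z = proj₁ (inverse {t} c≢b) in (z , (t , x) ∷ []) ∷ constantPolynomial (z *ᶠ - elem t b)

    indicatorOver : Dom t → List (Dom t) → Poly X
    indicatorOver c []       = constantPolynomial 1#
    indicatorOver c (b ∷ bs) = mulPolynomial (lagrangeFactor c b) (indicatorOver c bs)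

    indicator : Dom t → Poly X
    indicator c = indicatorOver c (allFin (card t))

    -- A case distinction as a polynomial: δ·G + (1 - δ)·Q with δ the indicator of x = c. Compared
    -- with summing the products δ·G, it lets the induction over an enumeration get by with
    -- membership of the point, without a count of its occurrences.
    switch : Dom t → Poly X → Poly X → Poly X
    switch c G Q = mulPolynomial (indicator c) G ++
      mulPolynomial (constantPolynomial 1# ++ mulPolynomial (constantPolynomial (- 1#)) (indicator c)) Q

    module _ (φ : Tuple X) where

      value-linear : ∀ z b → value φ ((z , (t , x) ∷ []) ∷ constantPolynomial (z *ᶠ - b)) ≈
                             z *ᶠ (elem t (All.lookup φ x) +ᶠ - b)
      value-linear z b = ≈-trans (+-cong (*-congˡ (*ᶠ-identityʳ _)) (value-constant φ _)) (≈-sym (distribˡ z _ _))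

      lagrangeFactor-one : ∀ c b → All.lookup φ x ≡ c → value φ (lagrangeFactor c b) ≈ 1#
      lagrangeFactor-one c b refl with c Fin.≟ b
      ... | yes _  = value-constant φ 1#
      ... | no c≢b = ≈-trans (value-linear _ (elem t b)) (proj₂ (inverse {t} c≢b))

      lagrangeFactor-zero : ∀ c b → All.lookup φ x ≡ b → b ≢ c → value φ (lagrangeFactor c b) ≈ 0#
      lagrangeFactor-zero c b refl b≢c with c Fin.≟ b
      ... | yes c≡b = ⊥-elim (b≢c (sym c≡b))
      ... | no c≢b  = ≈-trans (value-linear _ (elem t b)) (≈-trans (*-congˡ (-‿inverseʳ _)) (zeroʳ _))

      indicatorOver-one : ∀ c bs → All.lookup φ x ≡ c → value φ (indicatorOver c bs) ≈ 1#
      indicatorOver-one c []       eq = value-constant φ 1#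
      indicatorOver-one c (b ∷ bs) eq = ≈-trans (value-mul φ (lagrangeFactor c b) (indicatorOver c bs))
        (≈-trans (*-cong (lagrangeFactor-one c b eq) (indicatorOver-one c bs eq)) (*ᶠ-identityˡ 1#))

      indicatorOver-zero : ∀ c bs → All.lookup φ x ∈ bs → All.lookup φ x ≢ c → value φ (indicatorOver c bs) ≈ 0#
      indicatorOver-zero c (b ∷ bs) e∈ e≢c = ≈-trans (value-mul φ (lagrangeFactor c b) (indicatorOver c bs)) (vanish e∈)
        where
        vanish : All.lookup φ x ∈ b ∷ bs → value φ (lagrangeFactor c b) *ᶠ value φ (indicatorOver c bs) ≈ 0#
        vanish (here eq)   = ≈-trans (*-congʳ (lagrangeFactor-zero c b eq (e≢c ∘ trans eq))) (zeroˡ _)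
        vanish (there e∈) = ≈-trans (*-congˡ (indicatorOver-zero c bs e∈ e≢c)) (zeroʳ _)

      value-switch : ∀ c G Q → value φ (switch c G Q) ≈ value φ (indicator c) *ᶠ value φ G +ᶠ
                     (1# +ᶠ - 1# *ᶠ value φ (indicator c)) *ᶠ value φ Q
      value-switch c G Q = ≈-trans (value-++ φ (mulPolynomial (indicator c) G) _) (+-cong (value-mul φ (indicator c) G)
        (≈-trans (value-mul φ (constantPolynomial 1# ++ mulPolynomial (constantPolynomial (- 1#)) (indicator c)) Q)
          (*-congʳ (≈-trans (value-++ φ (constantPolynomial 1#) (mulPolynomial (constantPolynomial (- 1#)) (indicator c)))
            (+-cong (value-constant φ 1#)
              (≈-trans (value-mul φ (constantPolynomial (- 1#)) (indicator c)) (*-congʳ (value-constant φ (- 1#)))))))))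

      switch-yes : ∀ c G Q → All.lookup φ x ≡ c → value φ (switch c G Q) ≈ value φ G
      switch-yes c G Q eq = begin
        value φ (switch c G Q) ≈⟨ value-switch c G Q ⟩
        δ *ᶠ value φ G +ᶠ (1# +ᶠ - 1# *ᶠ δ) *ᶠ value φ Q
          ≈⟨ +-cong (*-congʳ δ≈1) (*-congʳ (+-congˡ (≈-trans (*-congˡ δ≈1) (*ᶠ-identityʳ _)))) ⟩
        1# *ᶠ value φ G +ᶠ (1# +ᶠ - 1#) *ᶠ value φ Q
          ≈⟨ +-cong (*ᶠ-identityˡ _) (≈-trans (*-congʳ (-‿inverseʳ 1#)) (zeroˡ _)) ⟩
        value φ G +ᶠ 0# ≈⟨ +ᶠ-identityʳ _ ⟩
        value φ G ∎
        where
        δ : Carrier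
        δ = value φ (indicator c)
        δ≈1 : δ ≈ 1#
        δ≈1 = indicatorOver-one c (allFin (card t)) eq

      switch-no : ∀ c G Q → All.lookup φ x ≢ c → value φ (switch c G Q) ≈ value φ Q
      switch-no c G Q e≢c = begin
        value φ (switch c G Q) ≈⟨ value-switch c G Q ⟩
        δ *ᶠ value φ G +ᶠ (1# +ᶠ - 1# *ᶠ δ) *ᶠ value φ Q
          ≈⟨ +-cong (*-congʳ δ≈0) (*-congʳ (+-congˡ (≈-trans (*-congˡ δ≈0) (zeroʳ _)))) ⟩
        0# *ᶠ value φ G +ᶠ (1# +ᶠ 0#) *ᶠ value φ Q
          ≈⟨ +-cong (zeroˡ _) (≈-trans (*-congʳ (+ᶠ-identityʳ 1#)) (*ᶠ-identityˡ _)) ⟩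
        0# +ᶠ value φ Q ≈⟨ +ᶠ-identityˡ _ ⟩
        value φ Q ∎
        where
        δ : Carrier
        δ = value φ (indicator c)
        δ≈0 : δ ≈ 0#
        δ≈0 = indicatorOver-zero c (allFin (card t)) (∈-allFin (All.lookup φ x)) e≢c

  -- The variables are treated one at a time, each by a chain of case distinctions over its domain.
  -- The degree is not optimized; it only has to depend on nothing but ts, the domains and h.
  interpolate : ∀ ts → (Tuple ts → Carrier) → Poly ts
  interpolateOver : ∀ t ts → (Tuple (t ∷ ts) → Carrier) → List (Dom t) → Poly (t ∷ ts)

  interpolate []       h = constantPolynomial (h [])
  interpolate (t ∷ ts) h = interpolateOver t ts h (allFin (card t))

  interpolateOver t ts h []       = []
  interpolateOver t ts h (c ∷ cs) =
    switch (here refl) c (renPolynomial there (interpolate ts (λ z → h (c ∷ z)))) (interpolateOver t ts h cs)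

  value-interpolate : ∀ {ts} h z → value z (interpolate ts h) ≈ h z
  value-interpolateOver : ∀ {t ts} h cs e z → e ∈ cs → value (e ∷ z) (interpolateOver t ts h cs) ≈ h (e ∷ z)

  value-interpolate h []      = value-constant [] (h [])
  value-interpolate h (e ∷ z) = value-interpolateOver h (allFin _) e z (∈-allFin e)

  value-interpolateOver {t} {ts} h (c ∷ cs) e z e∈ with e Fin.≟ c
  ... | yes refl = begin
    value (c ∷ z) (switch (here refl) c G Q)                     ≈⟨ switch-yes (here refl) (c ∷ z) c G Q refl ⟩
    value (c ∷ z) G                                              ≡⟨ value-ren z (c ∷ z) (λ _ → refl) (interpolate ts (λ z → h (c ∷ z))) ⟨
    value z (interpolate ts (λ z → h (c ∷ z)))                   ≈⟨ value-interpolate (λ z → h (c ∷ z)) z ⟩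
    h (c ∷ z)                                                    ∎
    where
    G Q : Poly (t ∷ ts)
    G = renPolynomial there (interpolate ts (λ z → h (c ∷ z)))
    Q = interpolateOver t ts h cs
  ... | no e≢c = ≈-trans (switch-no (here refl) (e ∷ z) c (renPolynomial there (interpolate ts (λ z → h (c ∷ z))))
                                    (interpolateOver t ts h cs) e≢c)
                         (value-interpolateOver h cs e z (remaining e∈))
    where
    remaining : e ∈ c ∷ cs → e ∈ cs
    remaining (here e≡c)  = ⊥-elim (e≢c e≡c)
    remaining (there e∈) = e∈

  maxDegree : ∀ {X} → Poly X → ℕ
  maxDegree []            = 0
  maxDegree ((_ , m) ∷ f) = length m ⊔ maxDegree f

  degree≤maxDegree : ∀ {X} (f : Poly X) {d} → maxDegree f ≤ d → DegreeAtMost {𝒟 = 𝒟} d f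
  degree≤maxDegree []            ≤d = []
  degree≤maxDegree ((_ , m) ∷ f) ≤d =
    ≤-trans (m≤m⊔n (length m) _) ≤d ∷ degree≤maxDegree f (≤-trans (m≤n⊔m (length m) _) ≤d)

-- Recognizing the relations of Δ

module _ {c ℓ₁ ℓ₂} {𝔽 : SizedField c ℓ₁ ℓ₂} where

  open SizedField 𝔽 using (_≈_; _#?_; tight; #-irrefl) renaming (refl to ≈-refl)

  trueT : Tree 𝔽
  trueT = cons nil nil

  matchT : Tree 𝔽 → Tree 𝔽 → Tree 𝔽
  -- `truth` does not separate `nil` from an atom. Comparing u with itself does: `equal` succeeds on
  -- atoms and fails on `nil`.
  matchT nil        u = ifT u nil (ifT (⟦ equal ⟧ (cons u u)) nil trueT)
  matchT (atom x)   u = ⟦ equal ⟧ (cons u (atom x))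
  matchT (cons v w) u = ifT u (ifT (matchT v (hdT u)) (matchT w (tlT u)) nil) nil

  match-polyTime : ∀ w → PolyTime (matchT w)
  match-polyTime nil        = ifᶜ input (constant nil) (ifᶜ (apply equal-polyTime (paired input input)) (constant nil) (constant trueT))
  match-polyTime (atom x)   = apply equal-polyTime (paired input (constant (atom x)))
  match-polyTime (cons v w) =
    ifᶜ input (ifᶜ (apply (match-polyTime v) (hdᶜ input)) (apply (match-polyTime w) (tlᶜ input)) (constant nil)) (constant nil)

  infix 4 _∼_

  -- The program compares atoms by `≈`, so a successful match determines a tree only up to this
  -- relation. Encodings are injective even so, because distinct elements of a domain are not `≈`.
  data _∼_ : Tree 𝔽 → Tree 𝔽 → Set (c ⊔ˡ ℓ₁) where
    nil  : nil ∼ nil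
    atom : ∀ {x y} → x ≈ y → atom x ∼ atom y
    cons : ∀ {v w v′ w′} → v ∼ v′ → w ∼ w′ → cons v w ∼ cons v′ w′

  equal-yes : ∀ x → truth {𝔽 = 𝔽} (⟦ equal ⟧ (cons (atom x) (atom x))) ≡ true
  equal-yes x with x #? x
  ... | yes x#x = ⊥-elim (#-irrefl ≈-refl x#x)
  ... | no  _   = refl

  match-refl : ∀ w → truth (matchT w w) ≡ true
  match-refl nil        = refl
  match-refl (atom x)   = equal-yes x
  match-refl (cons v w) = trans (cong truth (ifT-true (match-refl v))) (match-refl w)

  match-sound : ∀ w u → truth (matchT w u) ≡ true → w ∼ u
  match-sound nil        nil          eq = nil
  match-sound nil        (atom y)     eq with trans (sym eq) (cong truth (ifT-true {u = nil} {trueT} (equal-yes y)))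
  ... | ()
  match-sound (atom x)   (atom y)     eq with y #? x
  ... | no ¬y#x = atom (SizedField.sym 𝔽 (proj₁ (tight _ _) ¬y#x))
  match-sound (cons v w) (cons v′ w′) eq with truth (matchT v v′) in eq′
  ... | true = cons (match-sound v v′ eq′) (match-sound w w′ eq)

module Recognition {c ℓ₁ ℓ₂} {𝔽 : SizedField c ℓ₁ ℓ₂} (ℰ : Domains 𝔽) where

  open Domains ℰ using (Tuple; allTuples; injective)

  encodeℕ-injective : ∀ m n → encodeℕ {𝒟 = ℰ} m ∼ encodeℕ {𝒟 = ℰ} n → m ≡ n
  encodeℕ-injective zero    zero    _          = refl
  encodeℕ-injective (suc m) (suc n) (cons _ s) = cong suc (encodeℕ-injective m n s)

  encodeList-injective : ∀ {a} {A : Set a} {f : A → Tree 𝔽} → (∀ x y → f x ∼ f y → x ≡ y) →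
                         ∀ xs ys → encodeList {𝒟 = ℰ} f xs ∼ encodeList {𝒟 = ℰ} f ys → xs ≡ ys
  encodeList-injective inj []       []       _          = refl
  encodeList-injective inj (x ∷ xs) (y ∷ ys) (cons s r) = cong₂ _∷_ (inj x y s) (encodeList-injective inj xs ys r)

  encodeTuple-injective : ∀ {ts} (z z′ : Tuple ts) → encodeTuple {𝒟 = ℰ} z ∼ encodeTuple {𝒟 = ℰ} z′ → z ≡ z′
  encodeTuple-injective []      []        _                 = refl
  encodeTuple-injective {t ∷ _} (a ∷ z) (b ∷ z′) (cons (atom a≈b) r) =
    cong₂ _∷_ (injective t a≈b) (encodeTuple-injective z z′ r)

  ∈-allTuples : ∀ {ts} (z : Tuple ts) → z ∈ allTuples ts
  ∈-allTuples []      = here refl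
  ∈-allTuples (a ∷ z) = ∈-cartesianProductWith⁺ _∷_ (∈-allFin a) (∈-allTuples z)

  -- Both filters run over the same list, so whether x survives tells the value of the predicate at
  -- x.
  filterᵇ-injective : ∀ {a} {A : Set a} (p q : A → Bool) xs → filterᵇ p xs ≡ filterᵇ q xs →
                      ∀ {x} → x ∈ xs → p x ≡ q x
  filterᵇ-injective p q xs eq {x} x∈ with p x in px | q x in qx
  ... | true  | true  = refl
  ... | false | false = refl
  ... | true  | false = ⊥-elim (subst T qx (proj₂ (∈-filter⁻ (T? ∘ q) {xs = xs} (subst (x ∈_) eq
                          (∈-filter⁺ (T? ∘ p) x∈ (subst T (sym px) tt))))))
  ... | false | true  = ⊥-elim (subst T px (proj₂ (∈-filter⁻ (T? ∘ p) {xs = xs} (subst (x ∈_) (sym eq)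
                          (∈-filter⁺ (T? ∘ q) x∈ (subst T (sym qx) tt))))))

  -- Pointwise agreement, so that no function extensionality is involved.
  SameRelation : Relation ℰ → Relation ℰ → Set
  SameRelation R R′ = Σ (signature R ≡ signature R′) λ eq → ∀ z → holds R z ≡ holds R′ (subst Tuple eq z)

  encodeRelation-injective : ∀ R R′ → encodeRelation R ∼ encodeRelation R′ → SameRelation R R′
  encodeRelation-injective R R′ (cons s r) =
    same (signature R) (signature R′) (holds R) (holds R′)
      (encodeList-injective (λ t t′ s → Fin.toℕ-injective (encodeℕ-injective (toℕ t) (toℕ t′) s)) _ _ s) r
    where
    same : ∀ ts ts′ (h : Tuple ts → Bool) (h′ : Tuple ts′ → Bool) → ts ≡ ts′ →
           encodeList {𝒟 = ℰ} (encodeTuple {𝒟 = ℰ}) (filterᵇ h (allTuples ts)) ∼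
           encodeList {𝒟 = ℰ} (encodeTuple {𝒟 = ℰ}) (filterᵇ h′ (allTuples ts′)) →
           Σ (ts ≡ ts′) λ eq → ∀ z → h z ≡ h′ (subst Tuple eq z)
    same ts _ h h′ refl r = refl , λ z → filterᵇ-injective h h′ (allTuples ts)
      (encodeList-injective encodeTuple-injective _ _ r) (∈-allTuples z)

  module _ {J : Set} (Δ : Language ℰ J) (code : J → Tree 𝔽) where

    selectT : List J → Tree 𝔽 → Tree 𝔽
    selectT []       u = nil
    selectT (j ∷ js) u = ifT (matchT (encodeRelation (Δ j)) u) (code j) (selectT js u)

    select-polyTime : ∀ js → PolyTime (selectT js)
    select-polyTime []       = constant nil
    select-polyTime (j ∷ js) = ifᶜ (match-polyTime (encodeRelation (Δ j))) (constant (code j)) (select-polyTime js)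

    -- The search succeeds at j at the latest, since its own code matches. An earlier hit has the
    -- same signature and the same tuples, because encodings are injective.
    select-finds : ∀ {js j} → j ∈ js → Σ J λ j′ →
                   selectT js (encodeRelation (Δ j)) ≡ code j′ × SameRelation (Δ j) (Δ j′)
    select-finds {i ∷ js} {j} j∈ with truth (matchT (encodeRelation (Δ i)) (encodeRelation (Δ j))) in eq
    ... | true  = i , refl , symmetric (encodeRelation-injective (Δ i) (Δ j) (match-sound _ _ eq))
      where
      symmetric : ∀ {R R′} → SameRelation R R′ → SameRelation R′ R
      symmetric {R} {R′} (eq , h) = flip (signature R) (signature R′) (holds R) (holds R′) eq h
        where
        flip : ∀ ts ts′ (h : Tuple ts → Bool) (h′ : Tuple ts′ → Bool) (eq : ts ≡ ts′) →
               (∀ z → h z ≡ h′ (subst Tuple eq z)) → Σ (ts′ ≡ ts) λ eq → ∀ z → h′ z ≡ h (subst Tuple eq z)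
        flip _ _ h h′ refl h≡h′ = refl , λ z → sym (h≡h′ z)
    select-finds {i ∷ js} (here refl) | false with trans (sym eq) (match-refl (encodeRelation (Δ i)))
    ... | ()
    select-finds {i ∷ js} (there j∈)  | false = select-finds j∈

-- The pp-interpretation

module _ {c ℓ₁ ℓ₂} {𝔽 : SizedField c ℓ₁ ℓ₂} where

  map-mapWith∈-⟨⟩ : ∀ {a} {A : Set a} g w xs (p : ∀ {x : A} → x ∈ xs → Tree 𝔽) →
                    mapT g w ⟨ mapWith∈ xs p ⟩ ≡ ⟨ mapWith∈ xs (λ i → g w (p i)) ⟩
  map-mapWith∈-⟨⟩ g w xs p = trans (map-⟨⟩ g w (mapWith∈ xs p)) (cong ⟨_⟩ (map-mapWith∈ xs p (g w)))

  nth-allFin : ∀ {n} (f : Fin n → Tree 𝔽) i → nthT ⟨ map f (allFin n) ⟩ (unary (toℕ i)) ≡ f i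
  nth-allFin {n} f i = go (λ i → i) i
    where
    go : ∀ {m} (g : Fin m → Fin n) i → nthT ⟨ map f (tabulate g) ⟩ (unary (toℕ i)) ≡ f (g i)
    go g Fin.zero    = refl
    go g (Fin.suc i) = go (g ∘ Fin.suc) i

≤-maximum : ∀ {a} {A : Set a} (f : A → ℕ) {x xs} → x ∈ xs → f x ≤ foldr (λ y m → f y ⊔ m) 0 xs
≤-maximum f (here refl)        = m≤m⊔n _ _
≤-maximum f {xs = y ∷ _} (there x∈) = ≤-trans (≤-maximum f x∈) (m≤n⊔m (f y) _)

module Translation {c ℓ₁ ℓ₂} {𝔽 : SizedField c ℓ₁ ℓ₂} {𝒟 ℰ : Domains 𝔽} {I J : Set}
                   {Γ : Language 𝒟 I} {Δ : Language ℰ J} (Γ⊢Δ : PPInterprets Γ Δ) where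

  open FieldProperties 𝔽
  open Semantics 𝒟
  open Prenex Γ
  open Expansion Γ
  open Interpolation 𝒟
  open Recognition ℰ
  open PPInterprets Γ⊢Δ

  module D = Domains 𝒟
  module E = Domains ℰ
  module Eˢ = Semantics ℰ

  constraintsIn : ∀ {X} → List (Atom Γ X) → List (Constraint Γ X)
  constraintsIn []                   = []
  constraintsIn (constraint C ∷ L)   = C ∷ constraintsIn L
  constraintsIn (equality x y ∷ L)   = constraintsIn L

  equationsIn : ∀ {X} → List (Atom Γ X) → List (Equation X)
  equationsIn []                       = []
  equationsIn (constraint C ∷ L)       = equationsIn L
  equationsIn (equality {t} x y ∷ L)   = (t , x , y) ∷ equationsIn L

  module _ {X} {φ : D.Tuple X} where

    split : ∀ L → All (φ ⊨ₐ_) L → All (φ ⊨_) (constraintsIn L) × All (φ ⊨ᵉ_) (equationsIn L)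
    split []                 []       = [] , []
    split (constraint C ∷ L) (s ∷ ss) = let cs , es = split L ss in s ∷ cs , es
    split (equality x y ∷ L) (s ∷ ss) = let cs , es = split L ss in cs , s ∷ es

    unsplit : ∀ L → All (φ ⊨_) (constraintsIn L) → All (φ ⊨ᵉ_) (equationsIn L) → All (φ ⊨ₐ_) L
    unsplit []                 cs       es       = []
    unsplit (constraint C ∷ L) (c ∷ cs) es       = c ∷ unsplit L cs es
    unsplit (equality x y ∷ L) cs       (e ∷ es) = e ∷ unsplit L cs es

  module _ {ts} {P : D.Tuple ts → Set} (def : PPDefines Γ P) where

    definition : Template
    definition = record
      { ts          = ts
      ; us          = proj₁ def
      ; constraints = constraintsIn (proj₁ (proj₂ def))
      ; equations   = equationsIn (proj₁ (proj₂ def))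
      }

    defined⇒holds : ∀ z → P z → Holds definition z
    defined⇒holds z Pz = let w , sat = Equivalence.to (proj₂ (proj₂ def) z) Pz
                         in w , split (proj₁ (proj₂ def)) sat

    holds⇒defined : ∀ z → Holds definition z → P z
    holds⇒defined z (w , cs , es) = Equivalence.from (proj₂ (proj₂ def) z) (w , unsplit (proj₁ (proj₂ def)) cs es)

  blockValue : ∀ s → D.Tuple (coords s) → Carrier
  blockValue s z with T? (F s z)
  ... | yes Fz = E.elem s (π s (z , Fz))
  -- The default is arbitrary: the block formulas keep all solutions inside `F s`.
  ... | no  _  = 0#

  blockPolynomial : ∀ s → Poly (coords s)
  blockPolynomial s = interpolate (coords s) (blockValue s)

  value-blockPolynomial : ∀ {s} z (Fz : T (F s z)) → value z (blockPolynomial s) ≈ E.elem s (π s (z , Fz))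
  value-blockPolynomial {s} z Fz = ≈-trans (value-interpolate (blockValue s) z) (≈-reflexive correct)
    where
    correct : blockValue s z ≡ E.elem s (π s (z , Fz))
    correct with T? (F s z)
    ... | yes Fz′ = cong (λ p → E.elem s (π s (z , p))) (T-irrelevant Fz′ Fz)
    ... | no ¬Fz  = ⊥-elim (¬Fz Fz)

  K : ℕ
  K = foldr (λ s m → maxDegree (blockPolynomial s) ⊔ m) 0 (allFin E.sorts)

  degree-blockPolynomial : ∀ s → DegreeAtMost {𝒟 = 𝒟} K (blockPolynomial s)
  degree-blockPolynomial s = degree≤maxDegree (blockPolynomial s) (≤-maximum (maxDegree ∘ blockPolynomial) (∈-allFin s))

  blockTemplate : E.Sort → Template
  blockTemplate s = definition (defines-F s)

  relationTemplate : J → Template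
  relationTemplate j = definition (defines-π⁻¹ j)

  sortData : E.Sort → Tree 𝔽
  sortData s = cons (sortsCode (coords s)) (cons (templateCode (blockTemplate s)) (polynomialCode (blockPolynomial s)))

  -- A constant of the program. Interpolating π and unfolding the pp-definitions of the `F s` happen
  -- once per sort, outside the computation.
  sortTable : Tree 𝔽
  sortTable = ⟨ map (λ s → cons (range (coords s)) (sortData s)) (allFin E.sorts) ⟩

  relations : List J
  relations = map (Inverse.to (proj₂ finite)) (allFin (proj₁ finite))

  ∈-relations : ∀ j → j ∈ relations
  ∈-relations j = subst (_∈ relations) (Inverse.strictlyInverseˡ (proj₂ finite) j)
    (∈-map⁺ (Inverse.to (proj₂ finite)) (∈-allFin (Inverse.from (proj₂ finite) j)))

  recognizeT : Tree 𝔽 → Tree 𝔽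
  recognizeT = selectT Δ (templateCode ∘ relationTemplate) relations

  blocksT : Tree 𝔽 → Tree 𝔽
  blocksT X = layoutT nil (mapT nthT sortTable X)

  coordsT namesT polynomialT blockFormulaT constraintFormulaT : Tree 𝔽 → Tree 𝔽 → Tree 𝔽
  coordsT _ b             = hdT (tlT b)
  namesT _ b              = hdT b
  polynomialT _ b         = renPolynomialT (hdT b) (tlT (tlT (tlT b)))
  blockFormulaT _ b       = formulaT (hdT (tlT (tlT b))) (hdT b)
  constraintFormulaT Vs u = formulaT (recognizeT (tlT u)) (concatT (mapT nthT Vs (hdT u)))

  translateWithT : Tree 𝔽 → Tree 𝔽 → Tree 𝔽
  translateWithT bs u = cons (concatT (mapT coordsT nil bs))
    (cons (appendT (mapT blockFormulaT nil bs) (mapT constraintFormulaT (mapT namesT nil bs) (hdT u)))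
          (renPolynomialT (mapT polynomialT nil bs) (tlT u)))

  translateT : Tree 𝔽 → Tree 𝔽
  translateT u = translateWithT (blocksT (hdT u)) (tlT u)

  translate-polyTime : PolyTime translateT
  translate-polyTime = apply₂ translateWith-polyTime
    (layoutᶜ (constant nil) (mapᶜ nth-polyTime (constant sortTable) (hdᶜ input))) (tlᶜ input)
    where
    b : PolyTime tlT
    b = tlᶜ input
    formula : ∀ {f g} → PolyTime f → PolyTime g → PolyTime (λ u → formulaT (f u) (g u))
    formula C D = paired (hdᶜ C) (paired D (tlᶜ C))
    blocks : ∀ {g} → PolyTime₂ g → PolyTime (λ u → mapT g nil (hdT u))
    blocks P = mapᶜ P (constant nil) (hdᶜ input)
    constraintFormula-polyTime : PolyTime₂ constraintFormulaT
    constraintFormula-polyTime = curried (formula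
      (apply (select-polyTime Δ (templateCode ∘ relationTemplate) relations) (tlᶜ b))
      (apply concat-polyTime (mapᶜ nth-polyTime (hdᶜ input) (hdᶜ b))))
    translateWith-polyTime : PolyTime₂ translateWithT
    translateWith-polyTime = curried (paired
      (apply concat-polyTime (blocks (curried (hdᶜ (tlᶜ b)))))
      (paired
        (apply₂ append-polyTime (blocks (curried (formula (hdᶜ (tlᶜ (tlᶜ b))) (hdᶜ b))))
          (mapᶜ constraintFormula-polyTime (blocks (curried (hdᶜ b))) (hdᶜ (tlᶜ input))))
        (apply₂ renPolynomial-polyTime
          (blocks (curried (apply₂ renPolynomial-polyTime (hdᶜ b) (tlᶜ (tlᶜ (tlᶜ b))))))
          (tlᶜ (tlᶜ input)))))

  -- Solutions of an instance and of its translation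

  module Blocks (X : List E.Sort) where

    Y : List D.Sort
    Y = concatMap coords X

    block : ∀ {s} → s ∈ X → Ren (coords s) Y
    block i = ∈-block coords i

    blockScope : ∀ {s} → s ∈ X → All (_∈ Y) (coords s)
    blockScope i = All.tabulate (block i)

    flatScope : ∀ {ss} → All (_∈ X) ss → All (_∈ Y) (concatMap coords ss)
    flatScope []      = []
    flatScope (i ∷ V) = All.++⁺ (blockScope i) (flatScope V)

    found : (C : Constraint Δ X) → Σ J λ j′ →
            recognizeT (encodeRelation (Δ (Constraint.rel C))) ≡ templateCode (relationTemplate j′) ×
            SameRelation (Δ (Constraint.rel C)) (Δ j′)
    found C = select-finds Δ (templateCode ∘ relationTemplate) (∈-relations (Constraint.rel C))

    -- The program cannot tell apart relation symbols of Δ that denote the same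
    -- relation, so the constraint is restated with the symbol it picks.
    recognized : Constraint Δ X → Constraint Δ X
    recognized C = record
      { rel   = proj₁ (found C)
      ; scope = subst (All (_∈ X)) (proj₁ (proj₂ (proj₂ (found C)))) (Constraint.scope C)
      }

    recognized-⊨ : ∀ ψ C → (ψ ⊨ C) ≡ (ψ ⊨ recognized C)
    recognized-⊨ ψ C = same (proj₁ (proj₂ (proj₂ (found C)))) (holds (Δ (Constraint.rel C))) (holds (Δ (proj₁ (found C))))
      (proj₂ (proj₂ (proj₂ (found C)))) (Constraint.scope C)
      where
      same : ∀ {ts ts′} (eq : ts ≡ ts′) (h : E.Tuple ts → Bool) (h′ : E.Tuple ts′ → Bool) →
             (∀ z → h z ≡ h′ (subst E.Tuple eq z)) → ∀ V →
             T (h (atVars {𝒟 = ℰ} ψ V)) ≡ T (h′ (atVars {𝒟 = ℰ} ψ (subst (All (_∈ X)) eq V)))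
      same refl h h′ h≡h′ V = cong T (h≡h′ _)

    blockFormula : ∀ {s} → s ∈ X → Formula Y
    blockFormula {s} i = blockTemplate s at blockScope i

    constraintFormula : Constraint Δ X → Formula Y
    constraintFormula C = relationTemplate (Constraint.rel C) at flatScope (Constraint.scope C)

    formulasOf : List (Constraint Δ X) → List (Formula Y)
    formulasOf Cs = mapWith∈ X blockFormula ++ map (constraintFormula ∘ recognized) Cs

    blockPolynomialAt : Var {𝒟 = ℰ} X → Poly Y
    blockPolynomialAt (s , i) = renPolynomial (block i) (blockPolynomial s)

    substitute : Eˢ.Poly X → Composite Y
    substitute = map (λ (a , m) → a , map blockPolynomialAt m)

    substitute-degree : ∀ {d f} → DegreeAtMost {𝒟 = ℰ} d f → CompositeDegree K d (substitute f)
    substitute-degree []                          = []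
    substitute-degree {f = (_ , m) ∷ _} (m≤ ∷ f≤) =
      (≤-trans (≤-reflexive (List.length-map _ m)) m≤ ,
       All.map⁺ (All.tabulate λ {(s , i)} _ → renPolynomial-degree (block i) (degree-blockPolynomial s))) ∷
      substitute-degree f≤

    module _ (φ : D.Tuple Y) where

      blockOf : ∀ {s} → s ∈ X → D.Tuple (coords s)
      blockOf i = atVars {𝒟 = 𝒟} φ (blockScope i)

      blockOf-agrees : ∀ {s} (i : s ∈ X) → Agrees (block i) (blockOf i) φ
      blockOf-agrees i v = trans (lookup-atVars φ (blockScope i) v) (cong (All.lookup φ) (lookup-tabulate (block i) v))

      -- The relation between solutions that carries both directions. The block formulas make every
      -- solution of the translation represent some ψ, and surjectivity of π makes every ψ
      -- represented. The values of the two polynomials agree along it.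
      Represented : E.Tuple X → Set
      Represented ψ = ∀ {s} (i : s ∈ X) → Σ (T (F s (blockOf i))) λ p → π s (blockOf i , p) ≡ All.lookup ψ i

      module _ (ψ : E.Tuple X) (rep : Represented ψ) where

        blocksAt : ∀ {ss} → All (_∈ X) ss → All Block ss
        blocksAt = All.map (λ i → blockOf i , proj₁ (rep i))

        flatten-blocksAt : ∀ {ss} (V : All (_∈ X) ss) → flatten (blocksAt V) ≡ atVars {𝒟 = 𝒟} φ (flatScope V)
        flatten-blocksAt []      = refl
        flatten-blocksAt (i ∷ V) = trans (cong (All.++⁺ (blockOf i)) (flatten-blocksAt V))
                                         (sym (atVars-++⁺ φ (blockScope i) (flatScope V)))

        π-blocksAt : ∀ {ss} (V : All (_∈ X) ss) → All.map (λ {s} → π s) (blocksAt V) ≡ atVars {𝒟 = ℰ} ψ V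
        π-blocksAt V = trans (All.map-∘ V) (All.map-cong V (λ i → proj₂ (rep i)))

        -- `Preimage` only yields some blocks with the given concatenation. Their lengths are fixed
        -- by the sorts, so they are the blocks of φ.
        flatten-injective : ∀ {ss} (zs zs′ : All Block ss) → flatten zs ≡ flatten zs′ → zs ≡ zs′
        flatten-injective []             []               _  = refl
        flatten-injective ((z , p) ∷ zs) ((z′ , p′) ∷ zs′) eq with ++⁺-injective z z′ eq
        ... | refl , eq′ = cong₂ _∷_ (cong (z ,_) (T-irrelevant p p′)) (flatten-injective zs zs′ eq′)

        ⊨⇒⊨ᶠ : ∀ C → ψ ⊨ C → φ ⊨ᶠ constraintFormula C
        ⊨⇒⊨ᶠ C sat = defined⇒holds (defines-π⁻¹ (Constraint.rel C)) _
          (blocksAt V , flatten-blocksAt V , subst (T ∘ holds (Δ (Constraint.rel C))) (sym (π-blocksAt V)) sat)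
          where
          V : All (_∈ X) (signature (Δ (Constraint.rel C)))
          V = Constraint.scope C

        ⊨ᶠ⇒⊨ : ∀ C → φ ⊨ᶠ constraintFormula C → ψ ⊨ C
        ⊨ᶠ⇒⊨ C sat with holds⇒defined (defines-π⁻¹ (Constraint.rel C)) _ sat
        ... | zs , eq , q with flatten-injective zs (blocksAt (Constraint.scope C))
                                 (trans eq (sym (flatten-blocksAt (Constraint.scope C))))
        ... | refl = subst (T ∘ holds (Δ (Constraint.rel C))) (π-blocksAt (Constraint.scope C)) q

        value-substitute : ∀ f → compositeValue φ (substitute f) ≈ Eˢ.value ψ f
        value-substitute []            = ≈-refl
        value-substitute ((a , m) ∷ f) = +-cong (*-congˡ (monomial m)) (value-substitute f)
          where
          monomial : ∀ m → productValue φ (map blockPolynomialAt m) ≈ Eˢ.valueMonomial ψ m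
          monomial []            = ≈-refl
          monomial ((s , i) ∷ m) = *-cong
            (≈-trans (≈-reflexive (sym (value-ren (blockOf i) φ (blockOf-agrees i) (blockPolynomial s))))
              (≈-trans (value-blockPolynomial (blockOf i) (proj₁ (rep i)))
                       (≈-reflexive (cong (E.elem s) (proj₂ (rep i))))))
            (monomial m)

    module _ (Cs : List (Constraint Δ X)) where

      solution⁻ : ∀ φ → All (φ ⊨ᶠ_) (formulasOf Cs) → Σ (E.Tuple X) λ ψ → Represented φ ψ × All (ψ ⊨_) Cs
      solution⁻ φ sat = ψ , rep , All.map (λ {C} s → subst id (sym (recognized-⊨ ψ C)) (⊨ᶠ⇒⊨ φ ψ rep (recognized C) s))
                                          (All.map⁻ (All.++⁻ʳ (mapWith∈ X blockFormula) sat))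
        where
        inF : ∀ {s} (i : s ∈ X) → T (F s (blockOf φ i))
        inF {s} i = holds⇒defined (defines-F s) _
          (All-mapWith∈⁻ {P = φ ⊨ᶠ_} blockFormula (All.++⁻ˡ (mapWith∈ X blockFormula) sat) i)
        ψ : E.Tuple X
        ψ = All.tabulate (λ {s} i → π s (blockOf φ i , inF i))
        rep : Represented φ ψ
        rep i = inF i , sym (lookup-tabulate _ i)

      solution⁺ : ∀ ψ → All (ψ ⊨_) Cs → Σ (D.Tuple Y) λ φ → Represented φ ψ × All (φ ⊨ᶠ_) (formulasOf Cs)
      solution⁺ ψ sat = φ , rep , All.++⁺
        (All-mapWith∈⁺ blockFormula (λ {s} i → defined⇒holds (defines-F s) _ (proj₁ (rep i))))
        (All.map⁺ (All.map (λ {C} s → ⊨⇒⊨ᶠ φ ψ rep (recognized C) (subst id (recognized-⊨ ψ C) s)) sat))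
        where
        chosen : ∀ {s} (i : s ∈ X) → Σ (Block s) λ b → π s b ≡ All.lookup ψ i
        chosen {s} i = π-onto s (All.lookup ψ i)
        zs : All (D.Tuple ∘ coords) X
        zs = All.tabulate (λ i → proj₁ (proj₁ (chosen i)))
        φ : D.Tuple Y
        φ = flat coords zs
        rep : Represented φ ψ
        -- Membership in `F s` and the image under π are transported together, since π takes the
        -- membership proof as an argument.
        rep {s} i = subst (λ z → Σ (T (F s z)) λ p → π s (z , p) ≡ All.lookup ψ i)
          (lookup-extensional _ _ λ v → begin
            All.lookup (proj₁ (proj₁ (chosen i))) v ≡⟨ cong (λ z → All.lookup z v) (lookup-tabulate _ i) ⟨
            All.lookup (All.lookup zs i) v          ≡⟨ lookup-flat coords zs i v ⟨
            All.lookup φ (block i v)                ≡⟨ blockOf-agrees φ i v ⟨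
            All.lookup (blockOf φ i) v              ∎)
          (proj₂ (proj₁ (chosen i)) , proj₂ (chosen i))
          where open ≡-Reasoning

    blockEntry : ∀ {s} → s ∈ X → Tree 𝔽
    blockEntry {s} i = cons (table (block i)) (sortData s)

    blocks-code : blocksT (sortsCode X) ≡ ⟨ mapWith∈ X blockEntry ⟩
    blocks-code = trans
      (cong (layoutT nil) (trans (map-⟨⟩ nthT sortTable _) (cong ⟨_⟩
        (trans (sym (List.map-∘ X)) (List.map-cong (nth-allFin _) X)))))
      (layout-⟨⟩ coords sortData 0 X)

    formulaCode-at : ∀ τ (V : All (_∈ Y) (ts τ)) {u} → u ≡ varsCode V → formulaT (templateCode τ) u ≡ formulaCode (τ at V)
    formulaCode-at τ V refl = refl

    names : Tree 𝔽
    names = ⟨ mapWith∈ X (λ i → table (block i)) ⟩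

    flatScope-code : ∀ {ss} (V : All (_∈ X) ss) →
      concatT (mapT nthT names (varsCode V)) ≡ varsCode (flatScope V)
    flatScope-code []      = refl
    flatScope-code (i ∷ V) = trans
      (cong₂ appendT (trans (nth-mapWith∈ (λ i → table (block i)) i) (cong ⟨_⟩ (sym (reduce-tabulate var (block i)))))
                     (flatScope-code V))
      (trans (append-⟨⟩ (All.reduce var (blockScope i)) _)
             (cong ⟨_⟩ (sym (reduce-++⁺ var (blockScope i) (flatScope V)))))

    varsCode-subst : ∀ {ts ts′} (eq : ts ≡ ts′) (V : All (_∈ X) ts) → varsCode {𝔽 = 𝔽} V ≡ varsCode (subst (All (_∈ X)) eq V)
    varsCode-subst refl V = refl

    constraintFormula-code : ∀ C →
      constraintFormulaT names (Eˢ.constraintCode C) ≡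
      formulaCode (constraintFormula (recognized C))
    constraintFormula-code C = trans
      (cong (λ u → formulaT u (concatT (mapT nthT names (varsCode (Constraint.scope C)))))
            (proj₁ (proj₂ (found C))))
      (formulaCode-at (relationTemplate (proj₁ (found C))) (flatScope (Constraint.scope (recognized C)))
        (trans (cong (λ u → concatT (mapT nthT names u)) (varsCode-subst (proj₁ (proj₂ (proj₂ (found C)))) (Constraint.scope C)))
               (flatScope-code (Constraint.scope (recognized C)))))

    -- Renaming merely looks up entries of a table. With polynomials in place of variables as
    -- entries, the same program performs the substitution, leaving each term as a coefficient with
    -- its list of factors.
    substitute-code : ∀ f → renPolynomialT ⟨ mapWith∈ X (λ {s} i → polynomialCode (blockPolynomialAt (s , i))) ⟩
                                           (Eˢ.polynomialCode f) ≡ compositeCode (substitute f)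
    substitute-code []            = refl
    substitute-code ((a , m) ∷ f) = cong₂ (λ u v → cons (cons (atom a) u) v) (monomial m) (substitute-code f)
      where
      monomial : ∀ m → renVarsT ⟨ mapWith∈ X (λ {s} i → polynomialCode (blockPolynomialAt (s , i))) ⟩ (Eˢ.monomialCode m) ≡
                       factorsCode (map blockPolynomialAt m)
      monomial []            = refl
      monomial ((s , i) ∷ m) = cong₂ cons (nth-mapWith∈ _ i) (monomial m)

  translate : ∀ d → IMP d Δ ≤ₚ CompositeProblem K d
  translate d = ≤ₚ-intro translate-polyTime λ S → target S , code S , mk⇔ (to S) (from S)
    where
    target : IMPInstance d Δ → CompositeSystem K d
    target S = record
      { variables = Y
      ; formulas  = formulasOf constraints
      ; f         = substitute f
      ; degree    = substitute-degree degree
      }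
      where
      open IMPInstance S
      open Blocks vars

    to : ∀ S → Problem.Yes (IMP d Δ) S → Problem.Yes (CompositeProblem K d) (target S)
    to S yesS φ sat = let ψ , rep , sat′ = solution⁻ constraints φ sat
                      in ≈-trans (value-substitute φ ψ rep f) (yesS ψ sat′)
      where
      open IMPInstance S
      open Blocks vars

    from : ∀ S → Problem.Yes (CompositeProblem K d) (target S) → Problem.Yes (IMP d Δ) S
    from S yesT ψ sat = let φ , rep , sat′ = solution⁺ constraints ψ sat
                        in ≈-trans (≈-sym (value-substitute φ ψ rep f)) (yesT φ sat′)
      where
      open IMPInstance S
      open Blocks vars

    code : ∀ S → translateT (Problem.encode (IMP d Δ) S) ≡ Problem.encode (CompositeProblem K d) (target S)
    code S = trans (cong translateT (Eˢ.encodeIMP≡code S)) (trans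
      (cong (λ bs → translateWithT bs (cons (Eˢ.constraintsCode constraints) (Eˢ.polynomialCode f))) blocks-code)
      (cong₂ cons
        (trans (gather-⟨⟩ coordsT nil (unary ∘ toℕ) vars blockEntry (λ {s} _ → coords s) (λ _ → refl))
               (cong (sortsCode ∘ concat) (mapWith∈≗map coords vars)))
        (cong₂ cons
          (trans (cong₂ appendT
              (trans (map-mapWith∈-⟨⟩ blockFormulaT nil vars blockEntry) (cong ⟨_⟩ (trans
                (mapWith∈-cong vars _ _ (λ {s} i → formulaCode-at (blockTemplate s) (blockScope i)
                  (cong ⟨_⟩ (sym (reduce-tabulate var (block i))))))
                (sym (map-mapWith∈ vars blockFormula formulaCode)))))
              (trans (cong (λ u → mapT constraintFormulaT u (Eˢ.constraintsCode constraints))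
                           (map-mapWith∈-⟨⟩ namesT nil vars blockEntry))
                (trans (map-⟨⟩ constraintFormulaT _ _) (cong ⟨_⟩ (trans (sym (List.map-∘ constraints))
                  (trans (List.map-cong constraintFormula-code constraints) (List.map-∘ constraints)))))))
            (trans (append-⟨⟩ (map formulaCode (mapWith∈ vars blockFormula)) _)
                   (cong ⟨_⟩ (sym (List.map-++ formulaCode (mapWith∈ vars blockFormula) _)))))
          (trans (cong (λ u → renPolynomialT u (Eˢ.polynomialCode f))
                       (trans (map-mapWith∈-⟨⟩ polynomialT nil vars blockEntry)
                              (cong ⟨_⟩ (mapWith∈-cong vars _ _ (λ {s} i →
                                renPolynomial-code (nth-mapWith∈ (λ v → var (block i v))) (blockPolynomial s))))))
                 (substitute-code f)))))
      where
      open IMPInstance S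
      open Blocks vars

theorem3p7 : ∀ {c ℓ₁ ℓ₂} (𝔽 : SizedField c ℓ₁ ℓ₂) (𝒟 ℰ : Domains 𝔽) {I J : Set}
    (Γ : Language 𝒟 I) (Δ : Language ℰ J) → PPInterprets Γ Δ →
    ∃ λ (k : ℕ) → ∀ (d : ℕ) → IMP d Δ ≤ₚ IMP (k * d) Γ
theorem3p7 𝔽 𝒟 ℰ Γ Δ Γ⊢Δ = Translation.K Γ⊢Δ , λ d →
  ≤ₚ-trans (Translation.translate Γ⊢Δ d)
    (≤ₚ-trans (Expansion.expand Γ (Translation.K Γ⊢Δ) d)
      (≤ₚ-trans (Prenex.prenex Γ (Translation.K Γ⊢Δ * d)) (Elimination.eliminate Γ (Translation.K Γ⊢Δ * d))))
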